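{- Let $n\ge 1$ and let $a_1,\dots,a_n$ be pairwise relatively prime positive integers. Let $$\mathcal P=\Big\{(x_1,\dots,x_n)\in\mathbb R^n : x_k\ge 0 \text{ for all } k,\ \sum_{k=1}^n a_kx_k\le 1\Big\},$$ and for a positive integer $t$ let $L(\overline{\mathcal P},t)=\#(t\mathcal P\cap\mathbb Z^n)$ be the number of lattice points in $t\mathcal P=\{tx: x\in\mathcal P\}$. Then for every positive integer $t$, $$L(\overline{\mathcal P},t)=R_{ -t}(a_1,\dots,a_n)+(-1)^n\sum_{j=1}^n\sigma_{ -t}(a_1,\dots,\hat a_j,\dots,a_n,1;a_j),$$ where $\hat a_j$ means that the entry $a_j$ is omitted, and $R_{ -t}(a_1,\dots,a_n)=-\operatorname{Res}(F_{ -t}(z),z=1)$ with $$F_{ -t}(z)=\frac{z^{ -t-1}}{(1-z^{a_1})\cdots(1-z^{a_n})(1-z)}.$$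
   Context: Fourier-Dedekind sum: for integers $c_1,\dots,c_m$ each relatively prime to a positive integer $c$, and $t\in\mathbb Z$, $$\sigma_t(c_1,\dots,c_m;c)=\frac1c\sum_{\lambda^c=1,\ \lambda\ne1}\frac{\lambda^t}{(\lambda^{c_1}-1)\cdots(\lambda^{c_m}-1)},$$ the sum being over all complex $c$-th roots of unity $\lambda\neq 1$ (so it is $0$ if $c=1$). $\operatorname{Res}(F(z),z=1)$ denotes the residue of the meromorphic function $F$ at $z=1$. -}

module Defs where

open import Level using (Level; _⊔_; 0ℓ) renaming (suc to lsuc)
open import Algebra.Bundles using (CommutativeRing; AbelianGroup; RawSemiring; Semiring)
open import Algebra.Apartness.Bundles using (HeytingField; HeytingCommutativeRing)
import Algebra.Apartness.Properties.HeytingCommutativeRing as HeytingProperties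
import Algebra.Construct.DirectProduct as DirectProduct
import Algebra.Definitions.RawSemiring as RawSemiringDefinitions
import Algebra.Properties.CommutativeSemiring.Exp as Exp
import Algebra.Properties.Ring as RingProperties
import Algebra.Solver.Ring.NaturalCoefficients.Default as SemiringSolver
open import Data.Empty using (⊥-elim)
open import Data.Fin.Base as Fin using (Fin; toℕ; splitAt)
open import Data.Fin.Properties using (punchInᵢ≢i)
open import Data.Integer.Base as ℤ using (ℤ; +_; -[1+_]; 1ℤ)
import Data.Integer.Coprimality as ℤC
open import Data.Nat.Base as ℕ using (ℕ; zero; suc; NonZero; z≤n; s≤s)
import Data.Nat.Properties as ℕₚ
import Data.Nat.Coprimality as ℕC
open import Data.Nat.GCD using (module Bézout)
open import Data.Product.Base using (∃-syntax; _×_; _,_; proj₁; proj₂)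
open import Data.Sum.Base as Sum using (_⊎_; inj₁; inj₂)
open import Data.Vec.Base as Vec using (Vec)
open import Data.Vec.Functional using (Vector; removeAt; _++_)
import Data.Vec.Functional.Relation.Binary.Equality.Setoid as VectorEquality
open import Function.Base using (_∘_)
open import Function.Bundles using (Bijection; _⇔_; Equivalence)
open import Relation.Binary.Bundles using (Setoid)
import Relation.Binary.Construct.On as On
open import Relation.Binary.Core using (Rel)
open import Relation.Binary.PropositionalEquality as ≡ using (_≡_; _≢_)
import Relation.Binary.Reasoning.Setoid as ≈-Reasoning
open import Relation.Binary.Structures using (IsStrictPartialOrder)
open import Relation.Nullary.Negation using (¬_)

private
  variable
    c ℓ ℓ₁ ℓ₂ : Level

HasCardinality : Setoid c ℓ → ℕ → Set (c ⊔ ℓ)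
HasCardinality S n = Bijection (≡.setoid (Fin n)) S

module HeytingFieldArithmetic (K : HeytingField c ℓ₁ ℓ₂) where
  open HeytingField K public

  commutativeRing : CommutativeRing c ℓ₁
  commutativeRing = HeytingCommutativeRing.commutativeRing heytingCommutativeRing

  open CommutativeRing commutativeRing public
    using (ring; semiring; commutativeSemiring; +-abelianGroup)
  open HeytingProperties heytingCommutativeRing public
  open RawSemiringDefinitions (Semiring.rawSemiring semiring) public
    using (sum; product; _^_) renaming (_×_ to infixr 8 _·_)
  open Exp commutativeSemiring public using (^-congˡ; ^-congʳ; ^-homo-*; ^-assocʳ; ^-distrib-*)
  open RingProperties ring public using (-‿distribˡ-*; -‿distribʳ-*; -0#≈0#; -1*x≈-x; -‿involutive)
  open ≈-Reasoning setoid

  private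
    x*[y-z] : ∀ x y z → x * (y - z) ≈ x * y - x * z
    x*[y-z] x y z = trans (distribˡ x y (- z)) (+-congˡ (sym (-‿distribʳ-* x z)))

  unit⇒#0 : ∀ {x y} → x * y ≈ 1# → x # 0#
  unit⇒#0 {x} {y} xy≈1 = invertibleʳ⇒# (y , trans (*-congʳ (x-0≈x x)) xy≈1)

  inv : ∀ x → x # 0# → Carrier
  inv x x#0 = proj₁ (#⇒invertible x#0)

  inverseʳ : ∀ {x} (x#0 : x # 0#) → x * inv x x#0 ≈ 1#
  inverseʳ {x} x#0 = trans (*-congʳ (sym (x-0≈x x))) (proj₂ (proj₂ (#⇒invertible x#0)))

  infixl 7 _/_⟨_⟩
  _/_⟨_⟩ : ∀ x y → y # 0# → Carrier
  x / y ⟨ y#0 ⟩ = x * inv y y#0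

  infixr 8 _^ᶻ_⟨_⟩
  _^ᶻ_⟨_⟩ : ∀ x → ℤ → x # 0# → Carrier
  x ^ᶻ + n      ⟨ x#0 ⟩ = x ^ n
  x ^ᶻ -[1+ n ] ⟨ x#0 ⟩ = inv x x#0 ^ suc n

  #⇒-#0 : ∀ {x y} → x # y → x - y # 0#
  #⇒-#0 x#y = unit⇒#0 (proj₂ (proj₂ (#⇒invertible x#y)))

  *-#0ˡ : ∀ {x y} → x * y # 0# → x # 0#
  *-#0ˡ {x} {y} xy#0 = unit⇒#0 (trans (sym (*-assoc x y _)) (inverseʳ xy#0))

  *-#0ʳ : ∀ {x y} → x * y # 0# → y # 0#
  *-#0ʳ {x} {y} xy#0 = *-#0ˡ (#-congʳ (*-comm x y) xy#0)

  -‿#0 : ∀ {x} → - x # 0# → x # 0#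
  -‿#0 {x} -x#0 = *-#0ʳ { - 1# } (#-congʳ (begin
    - x         ≈⟨ -‿cong (*-identityˡ x) ⟨
    - (1# * x)  ≈⟨ -‿distribˡ-* 1# x ⟩
    - 1# * x    ∎) -x#0)

  *-strongˡ : ∀ {x y z} → x * y # x * z → y # z
  *-strongˡ {x} {y} {z} xy#xz = invertibleʳ⇒# (x * u , (begin
    (y - z) * (x * u)    ≈⟨ *-assoc (y - z) x u ⟨
    ((y - z) * x) * u    ≈⟨ *-congʳ (*-comm (y - z) x) ⟩
    (x * (y - z)) * u    ≈⟨ *-congʳ (x*[y-z] x y z) ⟩
    (x * y - x * z) * u  ≈⟨ proj₂ (proj₂ (#⇒invertible xy#xz)) ⟩
    1#                   ∎))
    where u = proj₁ (#⇒invertible xy#xz)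

  +-#0 : ∀ {x y} → x + y # 0# → x # 0# ⊎ y # 0#
  +-#0 {x} {y} x+y#0 with #-cotrans x+y#0 y
  ... | inj₂ y#0 = inj₂ y#0
  ... | inj₁ x+y#y = inj₁ (#-congʳ (begin
    (x + y) - y  ≈⟨ +-assoc x y (- y) ⟩
    x + (y - y)  ≈⟨ +-congˡ (-‿inverseʳ y) ⟩
    x + 0#       ≈⟨ +-identityʳ x ⟩
    x            ∎) (#⇒-#0 x+y#y))

  1^n≈1 : ∀ n → 1# ^ n ≈ 1#
  1^n≈1 zero    = refl
  1^n≈1 (suc n) = trans (*-identityˡ _) (1^n≈1 n)

  ^#1⇒#1 : ∀ x n → x ^ n # 1# → x # 1#
  ^#1⇒#1 x zero    1#1 = ⊥-elim (#-irrefl refl 1#1)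
  ^#1⇒#1 x (suc n) x^1+n#1 with #-cotrans x^1+n#1 x
  ... | inj₂ x#1     = x#1
  ... | inj₁ x^1+n#x = ^#1⇒#1 x n (*-strongˡ (#-congˡ (sym (*-identityʳ x)) x^1+n#x))

  product-#0 : ∀ {n} (xs : Vector Carrier n) → (∀ k → xs k # 0#) → product xs # 0#
  product-#0 {zero}  xs xs#0 = 1#0
  product-#0 {suc n} xs xs#0 = x#0y#0→xy#0 (xs#0 Fin.zero) (product-#0 (xs ∘ Fin.suc) (xs#0 ∘ Fin.suc))

  sum-0 : ∀ {n} (xs : Vector Carrier n) → (∀ k → xs k ≈ 0#) → sum xs ≈ 0#
  sum-0 {zero}  xs xs≈0 = refl
  sum-0 {suc n} xs xs≈0 =
    trans (+-cong (xs≈0 Fin.zero) (sum-0 (xs ∘ Fin.suc) (xs≈0 ∘ Fin.suc))) (+-identityʳ 0#)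

  sum-cong : ∀ {n} {xs ys : Vector Carrier n} → (∀ k → xs k ≈ ys k) → sum xs ≈ sum ys
  sum-cong {zero}  xs≈ys = refl
  sum-cong {suc n} xs≈ys = +-cong (xs≈ys Fin.zero) (sum-cong (xs≈ys ∘ Fin.suc))

CharacteristicZero : HeytingField c ℓ₁ ℓ₂ → Set ℓ₂
CharacteristicZero K = ∀ n → suc n · 1# # 0#
  where open HeytingFieldArithmetic K

module RootsOfUnity (K : HeytingField c ℓ₁ ℓ₂) where
  open HeytingFieldArithmetic K
  open ≈-Reasoning setoid

  record NontrivialRoot (d : ℕ) : Set (c ⊔ ℓ₁ ⊔ ℓ₂) where
    constructor mkRoot
    field
      value   : Carrier
      value^d : value ^ d ≈ 1#
      value#1 : value # 1#

  open NontrivialRoot public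

  nontrivialRoots : ℕ → Setoid (c ⊔ ℓ₁ ⊔ ℓ₂) ℓ₁
  nontrivialRoots d = On.setoid setoid (value {d})

  -- An enumeration of all the d-th roots of unity other than 1, of which ℂ has
  -- d - 1; sums over these roots are taken along an enumeration.
  NontrivialRootsOfUnity : ℕ → Set (c ⊔ ℓ₁ ⊔ ℓ₂)
  NontrivialRootsOfUnity d = HasCardinality (nontrivialRoots d) (d ℕ.∸ 1)

  root#0 : ∀ {d} .{{_ : NonZero d}} (ζ : NontrivialRoot d) → value ζ # 0#
  root#0 {suc d} ζ = unit⇒#0 (value^d ζ)

  inverseRoot : ∀ {d} .{{_ : NonZero d}} → NontrivialRoot d → NontrivialRoot d
  inverseRoot {d} ζ@(mkRoot x x^d≈1 x#1) = mkRoot y y^d≈1 y#1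
    where
    x#0 = root#0 ζ
    y   = inv x x#0

    y^d≈1 : y ^ d ≈ 1#
    y^d≈1 = begin
      y ^ d          ≈⟨ *-identityˡ _ ⟨
      1# * y ^ d     ≈⟨ *-congʳ x^d≈1 ⟨
      x ^ d * y ^ d  ≈⟨ ^-distrib-* x y d ⟨
      (x * y) ^ d    ≈⟨ ^-congˡ d (inverseʳ x#0) ⟩
      1# ^ d         ≈⟨ 1^n≈1 d ⟩
      1#             ∎

    y#1 : y # 1#
    y#1 = *-strongˡ (#-congʳ (sym (inverseʳ x#0)) (#-congˡ (sym (*-identityʳ x)) (#-sym x#1)))

  private
    x^[jd]≈1 : ∀ {d} (ζ : NontrivialRoot d) j → value ζ ^ (j ℕ.* d) ≈ 1#
    x^[jd]≈1 {d} (mkRoot x x^d≈1 _) j = begin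
      x ^ (j ℕ.* d)  ≈⟨ ^-congʳ x (ℕₚ.*-comm j d) ⟩
      x ^ (d ℕ.* j)  ≈⟨ ^-assocʳ x d j ⟨
      (x ^ d) ^ j    ≈⟨ ^-congˡ j x^d≈1 ⟩
      1# ^ j         ≈⟨ 1^n≈1 j ⟩
      1#             ∎

    [x^k]^i : ∀ x k i → (x ^ k) ^ i ≈ x ^ (i ℕ.* k)
    [x^k]^i x k i = trans (^-assocʳ x k i) (^-congʳ x (ℕₚ.*-comm k i))

  root^#1 : ∀ {d k} (ζ : NontrivialRoot d) → ℕC.Coprime k d → value ζ ^ k # 1#
  root^#1 {d} {k} ζ@(mkRoot x _ x#1) k⊥d with ℕC.coprime-Bézout k⊥d
  ... | Bézout.+- i j 1+jd≡ik = ^#1⇒#1 (x ^ k) i (#-congʳ (begin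
    x                  ≈⟨ *-identityʳ x ⟨
    x * 1#             ≈⟨ *-congˡ (x^[jd]≈1 ζ j) ⟨
    x * x ^ (j ℕ.* d)  ≡⟨ ≡.cong (x ^_) 1+jd≡ik ⟩
    x ^ (i ℕ.* k)      ≈⟨ [x^k]^i x k i ⟨
    (x ^ k) ^ i        ∎) x#1)
  ... | Bézout.-+ i j 1+ik≡jd = ^#1⇒#1 (x ^ k) i (*-strongˡ {x}
      (#-congʳ (sym x*[x^k]^i≈1) (#-congˡ (sym (*-identityʳ x)) (#-sym x#1))))
    where
    x*[x^k]^i≈1 : x * (x ^ k) ^ i ≈ 1#
    x*[x^k]^i≈1 = begin
      x * (x ^ k) ^ i    ≈⟨ *-congˡ ([x^k]^i x k i) ⟩
      x * x ^ (i ℕ.* k)  ≡⟨ ≡.cong (x ^_) 1+ik≡jd ⟩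
      x ^ (j ℕ.* d)      ≈⟨ x^[jd]≈1 ζ j ⟩
      1#                 ∎

  root^ᶻ#1 : ∀ {d} .{{_ : NonZero d}} (ζ : NontrivialRoot d) k → ℤC.Coprime k (+ d) →
             value ζ ^ᶻ k ⟨ root#0 ζ ⟩ # 1#
  root^ᶻ#1 ζ (+ n)    k⊥d = root^#1 ζ k⊥d
  root^ᶻ#1 ζ -[1+ n ] k⊥d = root^#1 (inverseRoot ζ) k⊥d

module FourierDedekind (K : HeytingField c ℓ₁ ℓ₂) (char0 : CharacteristicZero K) where
  open HeytingFieldArithmetic K
  open RootsOfUnity K

  n·1#0 : ∀ n .{{_ : NonZero n}} → n · 1# # 0#
  n·1#0 (suc n) = char0 n

  -- σ d roots t (c₁, …, cₘ) = σ_t(c₁, …, cₘ; d)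
  σ : (d : ℕ) .{{_ : NonZero d}} → NontrivialRootsOfUnity d → ℤ →
      ∀ {m} (cs : Vector ℤ m) → (∀ k → ℤC.Coprime (cs k) (+ d)) → Carrier
  σ d roots t {m} cs cs⊥d = sum summand / d · 1# ⟨ n·1#0 d ⟩
    where
    factor : NontrivialRoot d → Vector Carrier m
    factor ζ k = value ζ ^ᶻ cs k ⟨ root#0 ζ ⟩ - 1#

    factor#0 : ∀ ζ k → factor ζ k # 0#
    factor#0 ζ k = #⇒-#0 (root^ᶻ#1 ζ (cs k) (cs⊥d k))

    summand : Vector Carrier (d ℕ.∸ 1)
    summand i = value ζ ^ᶻ t ⟨ root#0 ζ ⟩ / product (factor ζ) ⟨ product-#0 (factor ζ) (factor#0 ζ) ⟩
      where ζ = Bijection.to roots i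

-- Formal Taylor and Laurent series at z = 1, in the local parameter w = z - 1.

module ExpansionAt1 (K : HeytingField c ℓ₁ ℓ₂) where
  open HeytingFieldArithmetic K
  open ≈-Reasoning setoid

  Series : Set c
  Series = ℕ → Carrier

  infix 4 _≋_
  _≋_ : Rel Series ℓ₁
  f ≋ g = ∀ n → f n ≈ g n

  0ˢ 1ˢ z : Series
  0ˢ _            = 0#
  1ˢ zero         = 1#
  1ˢ (suc _)      = 0#
  z zero          = 1#
  z (suc zero)    = 1#
  z (suc (suc _)) = 0#

  infixl 6 _+ˢ_ _-ˢ_
  _+ˢ_ _-ˢ_ : Series → Series → Series
  (f +ˢ g) n = f n + g n
  (f -ˢ g) n = f n - g n

  infixl 7 _*ˢ_
  _*ˢ_ : Series → Series → Series
  (f *ˢ g) n = sum {suc n} λ i → f (toℕ i) * g (n ℕ.∸ toℕ i)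

  rawSemiringˢ : RawSemiring c ℓ₁
  rawSemiringˢ = record { _≈_ = _≋_ ; _+_ = _+ˢ_ ; _*_ = _*ˢ_ ; 0# = 0ˢ ; 1# = 1ˢ }

  open RawSemiringDefinitions rawSemiringˢ public
    using () renaming (_^_ to infixr 8 _^ˢ_; product to productˢ)

  module Division (p q : Series) (q₀#0 : q 0 # 0#) where

    -- coefficients n lists the coefficients of w^(n-1), …, w, 1 in p / q.
    coefficients : ∀ n → Vec Carrier n
    tail         : ∀ n → Carrier

    coefficients zero    = Vec.[]
    coefficients (suc n) = (p n - tail n) / q 0 ⟨ q₀#0 ⟩ Vec.∷ coefficients n

    tail n = sum {n} λ i → q (suc (toℕ i)) * Vec.lookup (coefficients n) i

    quotient : Series
    quotient n = Vec.head (coefficients (suc n))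

    private
      lookup-coefficients : ∀ n (i : Fin (suc n)) →
                            Vec.lookup (coefficients (suc n)) i ≡ quotient (n ℕ.∸ toℕ i)
      lookup-coefficients n       Fin.zero    = ≡.refl
      lookup-coefficients (suc n) (Fin.suc i) = lookup-coefficients n i

      tail≈ : ∀ n → sum {n} (λ i → q (suc (toℕ i)) * quotient (n ℕ.∸ suc (toℕ i))) ≈ tail n
      tail≈ zero    = refl
      tail≈ (suc n) = sum-cong λ i → *-congˡ {q (suc (toℕ i))} (reflexive (≡.sym (lookup-coefficients n i)))

    q*quotient≋p : q *ˢ quotient ≋ p
    q*quotient≋p n = begin
      q 0 * ((p n - tail n) * q₀⁻¹) + _       ≈⟨ +-congˡ (tail≈ n) ⟩
      q 0 * ((p n - tail n) * q₀⁻¹) + tail n  ≈⟨ +-congʳ (*-congˡ (*-comm _ _)) ⟩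
      q 0 * (q₀⁻¹ * (p n - tail n)) + tail n  ≈⟨ +-congʳ (*-assoc _ _ _) ⟨
      q 0 * q₀⁻¹ * (p n - tail n) + tail n    ≈⟨ +-congʳ (*-congʳ (inverseʳ q₀#0)) ⟩
      1# * (p n - tail n) + tail n            ≈⟨ +-congʳ (*-identityˡ _) ⟩
      p n - tail n + tail n                   ≈⟨ +-assoc _ _ _ ⟩
      p n + (- tail n + tail n)               ≈⟨ +-congˡ (-‿inverseˡ _) ⟩
      p n + 0#                                ≈⟨ +-identityʳ _ ⟩
      p n                                     ∎
      where q₀⁻¹ = inv (q 0) q₀#0

  z⁻¹ : Series
  z⁻¹ = Division.quotient 1ˢ z 1#0

  z^_ : ℤ → Series
  z^ (+ n)    = z ^ˢ n
  z^ -[1+ n ] = z⁻¹ ^ˢ suc n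

  record HasOrder (f : Series) (v : ℕ) : Set (ℓ₁ ⊔ ℓ₂) where
    field
      lower   : ∀ {k} → k ℕ.< v → f k ≈ 0#
      leading : f v # 0#

  open HasOrder public

  -- laurent v f represents ∑ₖ f k · w^(k - v).
  record Laurent : Set c where
    constructor laurent
    field
      pole        : ℕ
      coefficient : Series

  -- p / q = w^(-v) · p / (q / w^v) for q of order v.
  laurentQuotient : (p q : Series) {v : ℕ} → HasOrder q v → Laurent
  laurentQuotient p q {v} q-order =
    laurent v (Division.quotient p (λ k → q (k ℕ.+ v)) (leading q-order))

  residue : Laurent → Carrier
  residue (laurent zero    f) = 0#
  residue (laurent (suc k) f) = f k

  private
    0*≈0 : ∀ {x y} → x ≈ 0# → x * y ≈ 0#
    0*≈0 x≈0 = trans (*-congʳ x≈0) (zeroˡ _)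

    *0≈0 : ∀ {x y} → y ≈ 0# → x * y ≈ 0#
    *0≈0 y≈0 = trans (*-congˡ y≈0) (zeroʳ _)

    0+0≈0 : ∀ {x y} → x ≈ 0# → y ≈ 0# → x + y ≈ 0#
    0+0≈0 x≈0 y≈0 = trans (+-cong x≈0 y≈0) (+-identityʳ 0#)

    0-x#0 : ∀ {x} → x # 0# → 0# - x # 0#
    0-x#0 x#0 = #⇒-#0 (#-sym x#0)

  *ˢ-order : ∀ {f g v} → HasOrder f 1 → HasOrder g v → HasOrder (f *ˢ g) (suc v)
  *ˢ-order {f} {g} {v} f-order g-order = record { lower = low _ ; leading = lead v g-order }
    where
    f₀≈0 = lower f-order (s≤s z≤n)

    low : ∀ n → n ℕ.< suc v → (f *ˢ g) n ≈ 0#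
    low zero    _         = 0+0≈0 (0*≈0 f₀≈0) refl
    low (suc n) (s≤s n<v) = 0+0≈0 (0*≈0 f₀≈0) (sum-0 {suc n} _ λ i →
      *0≈0 {f (suc (toℕ i))} (lower g-order (ℕₚ.≤-<-trans (ℕₚ.m∸n≤m n (toℕ i)) n<v)))

    rest : ℕ → Carrier
    rest u = sum {u} λ i → f (suc (suc (toℕ i))) * g (u ℕ.∸ suc (toℕ i))

    rest≈0 : ∀ u → HasOrder g u → rest u ≈ 0#
    rest≈0 zero    _     = refl
    rest≈0 (suc u) order = sum-0 {suc u} _ λ i →
      *0≈0 {f (suc (suc (toℕ i)))} (lower order (s≤s (ℕₚ.m∸n≤m u (toℕ i))))

    lead : ∀ u → HasOrder g u → (f *ˢ g) (suc u) # 0#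
    lead u order = #-congʳ (begin
      f 1 * g u                                  ≈⟨ +-identityʳ _ ⟨
      f 1 * g u + 0#                             ≈⟨ +-congˡ (rest≈0 u order) ⟨
      f 1 * g u + rest u                         ≈⟨ +-identityˡ _ ⟨
      0# + (f 1 * g u + rest u)                  ≈⟨ +-congʳ (0*≈0 f₀≈0) ⟨
      f 0 * g (suc u) + (f 1 * g u + rest u)     ∎) (x#0y#0→xy#0 (leading f-order) (leading order))

  productˢ-order : ∀ {n} (fs : Vector Series n) → (∀ k → HasOrder (fs k) 1) → HasOrder (productˢ fs) n
  productˢ-order {zero}  fs orders = record { lower = λ () ; leading = 1#0 }
  productˢ-order {suc n} fs orders =
    *ˢ-order (orders Fin.zero) (productˢ-order (fs ∘ Fin.suc) (orders ∘ Fin.suc))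

  z^n₀ : ∀ n → (z ^ˢ n) 0 ≈ 1#
  z^n₀ zero    = refl
  z^n₀ (suc n) = trans (+-identityʳ _) (trans (*-identityˡ _) (z^n₀ n))

  z^n₁ : ∀ n → (z ^ˢ n) 1 ≈ n · 1#
  z^n₁ zero    = refl
  z^n₁ (suc n) = begin
    1# * (z ^ˢ n) 1 + (1# * (z ^ˢ n) 0 + 0#)  ≈⟨ +-cong (*-identityˡ _) (+-identityʳ _) ⟩
    (z ^ˢ n) 1 + 1# * (z ^ˢ n) 0              ≈⟨ +-cong (z^n₁ n) (trans (*-identityˡ _) (z^n₀ n)) ⟩
    n · 1# + 1#                               ≈⟨ +-comm _ _ ⟩
    1# + n · 1#                               ∎

  1-z-order : HasOrder (1ˢ -ˢ z) 1
  1-z-order = record { lower = λ { (s≤s z≤n) → -‿inverseʳ 1# } ; leading = 0-x#0 1#0 }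

  1-z^n-order : ∀ n → n · 1# # 0# → HasOrder (1ˢ -ˢ z ^ˢ n) 1
  1-z^n-order n n#0 = record
    { lower   = λ { (s≤s z≤n) → trans (+-congˡ (-‿cong (z^n₀ n))) (-‿inverseʳ 1#) }
    ; leading = 0-x#0 (#-congʳ (sym (z^n₁ n)) n#0)
    }

module Residue (K : HeytingField c ℓ₁ ℓ₂) (char0 : CharacteristicZero K) where
  open HeytingFieldArithmetic K
  open FourierDedekind K char0 using (n·1#0)
  open ExpansionAt1 K

  denominator : ∀ {n} → Vector ℕ n → Series
  denominator a = (1ˢ -ˢ z) *ˢ productˢ (λ k → 1ˢ -ˢ z ^ˢ a k)

  denominator-order : ∀ {n} (a : Vector ℕ n) → (∀ k → NonZero (a k)) → HasOrder (denominator a) (suc n)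
  denominator-order a a≢0 = *ˢ-order 1-z-order
    (productˢ-order _ λ k → 1-z^n-order (a k) (n·1#0 (a k) {{a≢0 k}}))

  -- The Laurent expansion at z = 1 of z^(s-1) / ((1 - z^a₁)⋯(1 - z^aₙ)(1 - z)).
  F : ℤ → ∀ {n} (a : Vector ℕ n) → (∀ k → NonZero (a k)) → Laurent
  F s a a≢0 = laurentQuotient (z^ (s ℤ.- 1ℤ)) (denominator a) (denominator-order a a≢0)

  R : ℤ → ∀ {n} (a : Vector ℕ n) → (∀ k → NonZero (a k)) → Carrier
  R s a a≢0 = - residue (F s a a≢0)

-- The real numbers, axiomatised as an Archimedean, Cauchy complete ordered
-- field; classically this characterises ℝ up to isomorphism.

record RealNumbers c ℓ₁ ℓ₂ : Set (lsuc (c ⊔ ℓ₁ ⊔ ℓ₂)) where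
  infix 4 _<_ _≤_
  field
    heytingField : HeytingField c ℓ₁ ℓ₂

  open HeytingFieldArithmetic heytingField public

  field
    _<_                  : Rel Carrier ℓ₂
    isStrictPartialOrder : IsStrictPartialOrder _≈_ _<_
    #⇔<⊎>                : ∀ {x y} → x # y ⇔ (x < y ⊎ y < x)
    +-monoʳ-<            : ∀ x {y z} → y < z → x + y < x + z
    *-positive           : ∀ {x y} → 0# < x → 0# < y → 0# < x * y
    archimedean          : ∀ x → ∃[ n ] x < n · 1#
    complete             : (f : ℕ → Carrier) →
      (∀ {ε} → 0# < ε → ∃[ N ] (∀ {m n} → N ℕ.≤ m → N ℕ.≤ n → f m - f n < ε)) →
      ∃[ x ] (∀ {ε} → 0# < ε → ∃[ N ] (∀ {n} → N ℕ.≤ n → f n - x < ε × x - f n < ε))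

  open IsStrictPartialOrder isStrictPartialOrder public using (<-respʳ-≈; <-respˡ-≈)
    renaming (irrefl to <-irrefl; trans to <-trans)

  _≤_ : Rel Carrier ℓ₂
  x ≤ y = ¬ (y < x)

  fromℤ : ℤ → Carrier
  fromℤ (+ n)    = n · 1#
  fromℤ -[1+ n ] = - (suc n · 1#)

module OrderLemmas (ℝ : RealNumbers c ℓ₁ ℓ₂) where
  open RealNumbers ℝ
  open ≈-Reasoning setoid

  <⇒# : ∀ {x y} → x < y → x # y
  <⇒# = Equivalence.from #⇔<⊎> ∘ inj₁

  #⇒<⊎> : ∀ {x y} → x # y → x < y ⊎ y < x
  #⇒<⊎> = Equivalence.to #⇔<⊎>

  <-cotrans : ∀ {x y} → x < y → ∀ z → x < z ⊎ z < y
  <-cotrans x<y z with #-cotrans (<⇒# x<y) z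
  ... | inj₁ x#z with #⇒<⊎> x#z
  ...   | inj₁ x<z = inj₁ x<z
  ...   | inj₂ z<x = inj₂ (<-trans z<x x<y)
  <-cotrans x<y z | inj₂ z#y with #⇒<⊎> z#y
  ...   | inj₁ z<y = inj₂ z<y
  ...   | inj₂ y<z = inj₁ (<-trans x<y y<z)

  neg-positive : ∀ {x} → x < 0# → 0# < - x
  neg-positive {x} x<0 =
    <-respˡ-≈ (-‿inverseˡ x) (<-respʳ-≈ (+-identityʳ (- x)) (+-monoʳ-< (- x) x<0))

  +-positive : ∀ {x y} → 0# < x → 0# ≤ y → 0# < x + y
  +-positive {x} {y} 0<x 0≤y with <-cotrans 0<x (x + y)
  ... | inj₁ 0<x+y = 0<x+y
  ... | inj₂ x+y<x = ⊥-elim (0≤y (<-respˡ-≈ (begin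
    - x + (x + y)  ≈⟨ +-assoc (- x) x y ⟨
    - x + x + y    ≈⟨ +-congʳ (-‿inverseˡ x) ⟩
    0# + y         ≈⟨ +-identityˡ y ⟩
    y              ∎) (<-respʳ-≈ (-‿inverseˡ x) (+-monoʳ-< (- x) x+y<x))))

  square-positive : ∀ {x} → x # 0# → 0# < x * x
  square-positive {x} x#0 with #⇒<⊎> x#0
  ... | inj₂ 0<x = *-positive 0<x 0<x
  ... | inj₁ x<0 = <-respʳ-≈ (begin
    - x * - x      ≈⟨ -‿distribˡ-* x (- x) ⟨
    - (x * - x)    ≈⟨ -‿cong (sym (-‿distribʳ-* x x)) ⟩
    - (- (x * x))  ≈⟨ -‿involutive (x * x) ⟩
    x * x          ∎) (*-positive (neg-positive x<0) (neg-positive x<0))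

  square-nonNegative : ∀ x → 0# ≤ x * x
  square-nonNegative x x²<0 =
    <-irrefl refl (<-trans x²<0 (square-positive (*-#0ˡ (<⇒# x²<0))))

  0<1 : 0# < 1#
  0<1 = <-respʳ-≈ (*-identityˡ 1#) (square-positive 1#0)

  0≤n·1 : ∀ n → 0# ≤ n · 1#
  0≤n·1 zero    0<0     = <-irrefl refl 0<0
  0≤n·1 (suc n) 1+n·1<0 = <-irrefl refl (<-trans 1+n·1<0 (+-positive 0<1 (0≤n·1 n)))

  charZero : CharacteristicZero heytingField
  charZero n = #-sym (<⇒# (+-positive 0<1 (0≤n·1 n)))

module ComplexNumbers (ℝ : RealNumbers c ℓ₁ ℓ₂) where
  open RealNumbers ℝ
  open OrderLemmas ℝ

  infix  4 _#ᶜ_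
  infixl 7 _*ᶜ_

  additiveGroup : AbelianGroup c ℓ₁
  additiveGroup = DirectProduct.abelianGroup +-abelianGroup +-abelianGroup

  open AbelianGroup additiveGroup using ()
    renaming ( Carrier to Pair; _≈_ to infix 4 _≈ᶜ_; _∙_ to infixl 6 _+ᶜ_; ε to 0ᶜ; _⁻¹ to infix 8 -ᶜ_
             ; trans to ≈ᶜ-trans; ∙-cong to +ᶜ-cong; isAbelianGroup to +ᶜ-isAbelianGroup )

  _*ᶜ_ : Pair → Pair → Pair
  (a , b) *ᶜ (a′ , b′) = (a * a′ - b * b′ , a * b′ + b * a′)

  1ᶜ : Pair
  1ᶜ = (1# , 0#)

  _#ᶜ_ : Rel Pair ℓ₂
  (a , b) #ᶜ (a′ , b′) = a # a′ ⊎ b # b′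

  private
    open SemiringSolver commutativeSemiring using (solve; _:=_; _:+_; _:*_)
    open ≈-Reasoning setoid

    *ᶜ-cong : ∀ {x y u v} → x ≈ᶜ y → u ≈ᶜ v → x *ᶜ u ≈ᶜ y *ᶜ v
    *ᶜ-cong (p , q) (r , s) =
      +-cong (*-cong p r) (-‿cong (*-cong q s)) , +-cong (*-cong p s) (*-cong q r)

    *ᶜ-comm : ∀ x y → x *ᶜ y ≈ᶜ y *ᶜ x
    *ᶜ-comm (a , b) (a′ , b′) =
      +-cong (*-comm a a′) (-‿cong (*-comm b b′)) ,
      trans (+-comm _ _) (+-cong (*-comm b a′) (*-comm a b′))

    *ᶜ-identityˡ : ∀ x → 1ᶜ *ᶜ x ≈ᶜ x
    *ᶜ-identityˡ (a , b) = (begin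
      1# * a - 0# * b  ≈⟨ +-cong (*-identityˡ a) (trans (-‿cong (zeroˡ b)) -0#≈0#) ⟩
      a + 0#           ≈⟨ +-identityʳ a ⟩
      a                ∎) , (begin
      1# * b + 0# * a  ≈⟨ +-cong (*-identityˡ b) (zeroˡ a) ⟩
      b + 0#           ≈⟨ +-identityʳ b ⟩
      b                ∎)

    -x≈-1*x : ∀ {x} → - x ≈ - 1# * x
    -x≈-1*x {x} = sym (-1*x≈-x x)

    *ᶜ-assoc : ∀ x y u → (x *ᶜ y) *ᶜ u ≈ᶜ x *ᶜ (y *ᶜ u)
    *ᶜ-assoc (a , b) (a′ , b′) (a″ , b″) = (begin
      (a * a′ - b * b′) * a″ - (a * b′ + b * a′) * b″
        ≈⟨ +-cong (*-congʳ (+-congˡ -x≈-1*x)) -x≈-1*x ⟩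
      (a * a′ + i² * (b * b′)) * a″ + i² * ((a * b′ + b * a′) * b″)
        ≈⟨ solve 7 (λ a b a′ b′ a″ b″ i² →
             (a :* a′ :+ i² :* (b :* b′)) :* a″ :+ i² :* ((a :* b′ :+ b :* a′) :* b″) :=
             a :* (a′ :* a″ :+ i² :* (b′ :* b″)) :+ i² :* (b :* (a′ :* b″ :+ b′ :* a″)))
             refl a b a′ b′ a″ b″ i² ⟩
      a * (a′ * a″ + i² * (b′ * b″)) + i² * (b * (a′ * b″ + b′ * a″))
        ≈⟨ +-cong (*-congˡ (+-congˡ -x≈-1*x)) -x≈-1*x ⟨
      a * (a′ * a″ - b′ * b″) - b * (a′ * b″ + b′ * a″)
        ∎) , (begin
      (a * a′ - b * b′) * b″ + (a * b′ + b * a′) * a″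
        ≈⟨ +-congʳ (*-congʳ (+-congˡ -x≈-1*x)) ⟩
      (a * a′ + i² * (b * b′)) * b″ + (a * b′ + b * a′) * a″
        ≈⟨ solve 7 (λ a b a′ b′ a″ b″ i² →
             (a :* a′ :+ i² :* (b :* b′)) :* b″ :+ (a :* b′ :+ b :* a′) :* a″ :=
             a :* (a′ :* b″ :+ b′ :* a″) :+ b :* (a′ :* a″ :+ i² :* (b′ :* b″)))
             refl a b a′ b′ a″ b″ i² ⟩
      a * (a′ * b″ + b′ * a″) + b * (a′ * a″ + i² * (b′ * b″))
        ≈⟨ +-congˡ (*-congˡ (+-congˡ -x≈-1*x)) ⟨
      a * (a′ * b″ + b′ * a″) + b * (a′ * a″ - b′ * b″)
        ∎)
      where i² = - 1#

    *ᶜ-distribˡ-+ᶜ : ∀ x y u → x *ᶜ (y +ᶜ u) ≈ᶜ x *ᶜ y +ᶜ x *ᶜ u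
    *ᶜ-distribˡ-+ᶜ (a , b) (a′ , b′) (a″ , b″) = (begin
      a * (a′ + a″) - b * (b′ + b″)
        ≈⟨ +-congˡ -x≈-1*x ⟩
      a * (a′ + a″) + i² * (b * (b′ + b″))
        ≈⟨ solve 7 (λ a b a′ b′ a″ b″ i² →
             a :* (a′ :+ a″) :+ i² :* (b :* (b′ :+ b″)) :=
             (a :* a′ :+ i² :* (b :* b′)) :+ (a :* a″ :+ i² :* (b :* b″)))
             refl a b a′ b′ a″ b″ i² ⟩
      (a * a′ + i² * (b * b′)) + (a * a″ + i² * (b * b″))
        ≈⟨ +-cong (+-congˡ -x≈-1*x) (+-congˡ -x≈-1*x) ⟨
      (a * a′ - b * b′) + (a * a″ - b * b″)
        ∎) ,
      solve 6 (λ a b a′ b′ a″ b″ →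
        a :* (b′ :+ b″) :+ b :* (a′ :+ a″) :=
        (a :* b′ :+ b :* a′) :+ (a :* b″ :+ b :* a″))
        refl a b a′ b′ a″ b″
      where i² = - 1#

    *ᶜ-identityʳ : ∀ x → x *ᶜ 1ᶜ ≈ᶜ x
    *ᶜ-identityʳ x = ≈ᶜ-trans (*ᶜ-comm x 1ᶜ) (*ᶜ-identityˡ x)

    *ᶜ-distribʳ-+ᶜ : ∀ x y u → (y +ᶜ u) *ᶜ x ≈ᶜ y *ᶜ x +ᶜ u *ᶜ x
    *ᶜ-distribʳ-+ᶜ x y u = ≈ᶜ-trans (*ᶜ-comm (y +ᶜ u) x)
      (≈ᶜ-trans (*ᶜ-distribˡ-+ᶜ x y u) (+ᶜ-cong (*ᶜ-comm x y) (*ᶜ-comm x u)))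

    -- The inverse of a + bi is (a - bi) / (a² + b²).
    norm²#0 : ∀ {a b} → a # 0# ⊎ b # 0# → a * a + b * b # 0#
    norm²#0 {a} {b} (inj₁ a#0) =
      #-sym (<⇒# (+-positive (square-positive a#0) (square-nonNegative b)))
    norm²#0 {a} {b} (inj₂ b#0) = #-congʳ (+-comm (b * b) (a * a))
      (#-sym (<⇒# (+-positive (square-positive b#0) (square-nonNegative a))))

    #0⇒unit : ∀ x → x #ᶜ 0ᶜ → ∃[ y ] x *ᶜ y ≈ᶜ 1ᶜ
    #0⇒unit (a , b) x#0 = (a * N⁻¹ , - (b * N⁻¹)) , (begin
      a * (a * N⁻¹) - b * - (b * N⁻¹)      ≈⟨ +-congˡ (-‿cong (-‿distribʳ-* b _)) ⟨
      a * (a * N⁻¹) - - (b * (b * N⁻¹))    ≈⟨ +-congˡ (-‿involutive _) ⟩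
      a * (a * N⁻¹) + b * (b * N⁻¹)        ≈⟨ +-cong (*-assoc a a N⁻¹) (*-assoc b b N⁻¹) ⟨
      a * a * N⁻¹ + b * b * N⁻¹            ≈⟨ distribʳ N⁻¹ (a * a) (b * b) ⟨
      (a * a + b * b) * N⁻¹                ≈⟨ inverseʳ N#0 ⟩
      1#                                   ∎) , (begin
      a * - (b * N⁻¹) + b * (a * N⁻¹)      ≈⟨ +-congʳ (-‿distribʳ-* a _) ⟨
      - (a * (b * N⁻¹)) + b * (a * N⁻¹)    ≈⟨ +-congˡ (*-assoc b a N⁻¹) ⟨
      - (a * (b * N⁻¹)) + b * a * N⁻¹      ≈⟨ +-congˡ (*-congʳ (*-comm b a)) ⟩
      - (a * (b * N⁻¹)) + a * b * N⁻¹      ≈⟨ +-congˡ (*-assoc a b N⁻¹) ⟩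
      - (a * (b * N⁻¹)) + a * (b * N⁻¹)    ≈⟨ -‿inverseˡ _ ⟩
      0#                                   ∎)
      where
      N#0 = norm²#0 {a} {b} x#0
      N⁻¹ = inv (a * a + b * b) N#0

    unit⇒#0ᶜ : ∀ x y → x *ᶜ y ≈ᶜ 1ᶜ → x #ᶜ 0ᶜ
    unit⇒#0ᶜ (a , b) (a′ , b′) (re≈1 , _) =
      Sum.map *-#0ˡ (*-#0ˡ ∘ -‿#0) (+-#0 (#-congʳ (sym re≈1) 1#0))

    #-diff : ∀ {x y} → x - y # 0# → x # y
    #-diff {x} {y} x-y#0 = invertibleʳ⇒# (inv (x - y) x-y#0 , inverseʳ x-y#0)

  ℂ : HeytingField c ℓ₁ ℓ₂
  ℂ = record
    { Carrier = Pair ; _≈_ = _≈ᶜ_ ; _#_ = _#ᶜ_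
    ; _+_ = _+ᶜ_ ; _*_ = _*ᶜ_ ; -_ = -ᶜ_ ; 0# = 0ᶜ ; 1# = 1ᶜ
    ; isHeytingField = record
      { isHeytingCommutativeRing = record
        { isCommutativeRing = record
          { isRing = record
            { +-isAbelianGroup = +ᶜ-isAbelianGroup
            ; *-cong           = *ᶜ-cong
            ; *-assoc          = *ᶜ-assoc
            ; *-identity       = *ᶜ-identityˡ , *ᶜ-identityʳ
            ; distrib          = *ᶜ-distribˡ-+ᶜ , *ᶜ-distribʳ-+ᶜ
            }
          ; *-comm = *ᶜ-comm
          }
        ; isApartnessRelation = record
          { irrefl  = λ { (p , q) (inj₁ a#a′) → #-irrefl p a#a′ ; (p , q) (inj₂ b#b′) → #-irrefl q b#b′ }
          ; sym     = Sum.map #-sym #-sym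
          ; cotrans = λ
            { (inj₁ a#a′) (u , v) → Sum.map inj₁ inj₁ (#-cotrans a#a′ u)
            ; (inj₂ b#b′) (u , v) → Sum.map inj₂ inj₂ (#-cotrans b#b′ v)
            }
          }
        ; #⇒invertible = λ {x} {y} x#y →
            let u , eq = #0⇒unit (x +ᶜ -ᶜ y) (Sum.map #⇒-#0 #⇒-#0 x#y)
            in u , ≈ᶜ-trans (*ᶜ-comm u (x +ᶜ -ᶜ y)) eq , eq
        ; invertible⇒# = λ {x} {y} (u , _ , eq) →
            Sum.map #-diff #-diff (unit⇒#0ᶜ (x +ᶜ -ᶜ y) u eq)
        }
      ; tight = λ x y →
          (λ ¬x#y → proj₁ (tight _ _) (¬x#y ∘ inj₁) , proj₁ (tight _ _) (¬x#y ∘ inj₂)) ,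
          (λ { (p , q) (inj₁ a#a′) → #-irrefl p a#a′ ; (p , q) (inj₂ b#b′) → #-irrefl q b#b′ })
      }
    }

  ℂ-charZero : CharacteristicZero ℂ
  ℂ-charZero n = inj₁ (#-congʳ (sym (re (suc n))) (charZero n))
    where
    re : ∀ n → proj₁ (HeytingFieldArithmetic._·_ ℂ n 1ᶜ) ≈ n · 1#
    re zero    = refl
    re (suc n) = +-congˡ (re n)

module Polytope (ℝ : RealNumbers c ℓ₁ ℓ₂) where
  open RealNumbers ℝ

  𝒫 : ∀ {n} → Vector ℕ n → Vector Carrier n → Set ℓ₂
  𝒫 a x = (∀ k → 0# ≤ x k) × sum (λ k → a k · x k) ≤ 1#

  dilate : ∀ {n} → ℕ → (Vector Carrier n → Set ℓ) → Vector Carrier n → Set (c ⊔ ℓ ⊔ ℓ₁)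
  dilate t S y = ∃[ x ] S x × (∀ k → y k ≈ t · x k)

  latticePoints : ∀ {n} → (Vector Carrier n → Set ℓ) → Setoid ℓ 0ℓ
  latticePoints {n = n} S =
    On.setoid {B = ∃[ x ] S (fromℤ ∘ x)} (VectorEquality.≋-setoid (≡.setoid ℤ) n) proj₁

PairwiseCoprime : ∀ {n} → Vector ℕ n → Set
PairwiseCoprime a = ∀ {i j} → i ≢ j → ℕC.Coprime (a i) (a j)

-- (a₁, …, âⱼ, …, aₙ, 1)
omit : ∀ {n} → Vector ℕ (suc n) → Fin (suc n) → Vector ℤ (n ℕ.+ 1)
omit a j = (+_ ∘ removeAt a j) ++ (λ _ → 1ℤ)

omit-coprime : ∀ {n} (a : Vector ℕ (suc n)) → PairwiseCoprime a →
               ∀ j k → ℤC.Coprime (omit a j k) (+ a j)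
omit-coprime {n} a coprime j k with splitAt n k
... | inj₁ i = coprime (punchInᵢ≢i j i)
... | inj₂ _ = ℕC.1-coprimeTo (a j)

module LatticePointFormula (ℝ : RealNumbers c ℓ₁ ℓ₂) where
  open ComplexNumbers ℝ public using (ℂ; ℂ-charZero)
  open HeytingFieldArithmetic ℂ public
  open RootsOfUnity ℂ public using (NontrivialRootsOfUnity)
  open FourierDedekind ℂ ℂ-charZero public using (σ)
  open Residue ℂ ℂ-charZero public using (R)
  open Polytope ℝ public using (𝒫; dilate; latticePoints)

{-# OPTIONS --safe #-}
-- The sum over all the poles ρ of Res (z^(-u) / ((1 - z)^r ∏ₖ (1 - z^bₖ)), z = ρ)
-- is 0 for u ≥ 1.  At r = 1 and u = t + 1 the residue at 0 is the coefficient of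
-- z^t in the generating function of the numbers of lattice points, the one at 1
-- gives R_{-t}, and those at the other roots of unity give the Fourier-Dedekind
-- sums.  No partial fractions are needed: the sum D_{r,b}(u) satisfies
--   D_{r,b}(bₖ + u) = D_{r,b}(u) + D_{r,b∖bₖ}(bₖ + u)
--   D_{r+1,b}(1 + u) = D_{r+1,b}(u) + D_{r,b}(1 + u),
-- so that by induction it has the coprime periods bₖ and is constant, and then
-- b₀ D_{r,b} = D_{r+1,b}(b₀) - D_{r+1,b}(0) = 0.  The case r = 0, n = 1 is the
-- orthogonality of the d-th roots of unity, which follows from the fact that a
-- polynomial of degree less than d with d distinct roots is 0.
module Submission where

open import Defs
open import Level using (Level; _⊔_)
open import Algebra.Apartness.Bundles using (HeytingField)
open import Algebra.Bundles using (CommutativeMonoid; CommutativeRing; CommutativeSemiring)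
import Algebra.Definitions.RawSemiring as RawSemiringDefinitions
import Algebra.Properties.AbelianGroup as AbelianGroupProperties
import Algebra.Properties.CommutativeMonoid.Sum as CommutativeMonoidSum
import Algebra.Properties.CommutativeSemigroup as CommutativeSemigroupProperties
import Algebra.Properties.CommutativeSemiring.Exp as Exp
import Algebra.Properties.Semiring.Mult as SemiringMult
import Algebra.Properties.Semiring.Sum as SemiringSum
import Algebra.Solver.Ring.NaturalCoefficients.Default as SemiringSolver
open import Data.Empty using (⊥-elim)
open import Data.Fin.Base as Fin using (Fin; toℕ; fromℕ<; punchIn; splitAt; join)
open import Data.Fin.Properties
  using (toℕ-fromℕ<; punchIn-injective; punchInᵢ≢i; splitAt-join; join-splitAt)
open import Data.Integer.Base as ℤ using (ℤ; +_; -[1+_]; 1ℤ)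
import Data.Integer.Properties as ℤₚ
open import Data.Nat.Base as ℕ using (ℕ; zero; suc; NonZero; z≤n; s≤s)
import Data.Nat.Coprimality as ℕC
open import Data.Nat.DivMod using (m≡m%n+[m/n]*n; m%n<n)
open import Data.Nat.GCD using (module Bézout)
open import Data.Nat.Induction using (<-rec)
import Data.Nat.Properties as ℕₚ
open import Data.Product.Base using (∃-syntax; _×_; _,_; proj₁; proj₂)
open import Data.Sum.Base using (_⊎_; inj₁; inj₂; [_,_]′)
import Data.Sum.Properties as Sumₚ
open import Data.Vec.Functional using (Vector; removeAt; tail; _∷_; _++_)
import Data.Vec.Functional.Relation.Binary.Equality.Setoid as VectorEquality
open import Function.Base using (_∘_)
open import Function.Bundles using (Bijection)
open import Relation.Binary.Bundles using (Setoid)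
import Relation.Binary.Construct.On as On
open import Relation.Binary.PropositionalEquality as ≡ using (_≡_; _≢_)
import Relation.Binary.Reasoning.Setoid as ≈-Reasoning
open import Relation.Binary.Structures using (IsEquivalence)
open import Relation.Nullary.Decidable using (yes; no)
open import Relation.Nullary.Negation using (¬_)

-- Both recurrences are instances of 1/(1 - y) = 1 + y/(1 - y) applied to a single factor. The
-- identity can be checked separately at 0, at 1 and at the other roots of unity, so no analytic
-- residue theorem is needed. It fails only for 1 - z^bₖ at its own roots, where z^bₖ = 1 makes the
-- contribution periodic, which is what the recurrence asks for. The parameter `r` exists because
-- passing from "constant" to "zero" costs one more factor 1 - z, paid for by dropping one bₖ.
-- Exponents must be positive and some factor must be present: otherwise a residue at infinity can
-- survive. The field is constructive and the roots come as a bare enumeration, without a primitive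
-- root. Inverting 1 - ω^x therefore needs apartness from 1, which is obtained from geometric sums.

private
  variable
    c ℓ ℓ₁ ℓ₂ ℓ₃ c₁ c₂ c₃ : Level

-- Identities in commutative semirings, shared by the field and its power series

module SemiringIdentities {c ℓ} (S : CommutativeSemiring c ℓ) where
  open CommutativeSemiring S
  open RawSemiringDefinitions (CommutativeSemiring.rawSemiring S) using (product; _^_)
  open Exp S using (^-homo-*; ^-distrib-*; ^-congˡ)
  open CommutativeMonoidSum *-commutativeMonoid using () renaming (sum-remove to product-remove; sum-cong-≗ to product-cong-≗)
  open SemiringSolver S using (solve; _:=_; _:+_; _:*_; con)
  open ≈-Reasoning setoid

  -- Here `q` is (1 - `x`) / `v` and `r` is `v` / (1 - `x`). Phrased without subtraction, this
  -- serves the semiring of series as well: with `v` = 1 at 0 and at the roots of unity, and with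
  -- `v` = `w` at 1, where each factor costs one order of the pole.
  reciprocal-step : ∀ {x v q r} → q * r ≈ 1# → 1# ≈ x + v * q → r ≈ v + x * r
  reciprocal-step {x} {v} {q} {r} qr≈1 1≈x+vq = begin
    r                    ≈⟨ *-identityˡ r ⟨
    1# * r               ≈⟨ *-congʳ 1≈x+vq ⟩
    (x + v * q) * r      ≈⟨ solve 4 (λ x v q r → (x :+ v :* q) :* r := v :* (q :* r) :+ x :* r) refl x v q r ⟩
    v * (q * r) + x * r  ≈⟨ +-congʳ (trans (*-congˡ qr≈1) (*-identityʳ v)) ⟩
    v + x * r            ∎

  power-step : ∀ {r v y} → r ≈ v + y * r → ∀ n p → r ^ suc n * p ≈ v * (r ^ n * p) + y * (r ^ suc n * p)
  power-step {r} {v} {y} r≈ n p = trans (*-congʳ (*-congʳ r≈))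
    (solve 5 (λ v y r q p → (v :+ y :* r) :* q :* p := v :* (q :* p) :+ y :* (r :* q :* p)) refl v y r (r ^ n) p)

  product-step : ∀ {n} (f : Vector Carrier (suc n)) k {v y} → f k ≈ v + y * f k → ∀ q →
                 q * product f ≈ v * (q * product (removeAt f k)) + y * (q * product f)
  product-step f k {v} {y} fk≈ q = begin
    q * product f                            ≈⟨ *-congˡ (product-remove {i = k} f) ⟩
    q * (f k * p)                            ≈⟨ *-congˡ (*-congʳ fk≈) ⟩
    q * ((v + y * f k) * p)                  ≈⟨ solve 5 (λ v y r q p → q :* ((v :+ y :* r) :* p) := v :* (q :* p) :+ y :* (q :* (r :* p))) refl v y (f k) q p ⟩
    v * (q * p) + y * (q * (f k * p))        ≈⟨ +-congˡ (*-congˡ (*-congˡ (product-remove {i = k} f))) ⟨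
    v * (q * p) + y * (q * product f)        ∎
    where p = product (removeAt f k)

  1^n≈1 : ∀ n → 1# ^ n ≈ 1#
  1^n≈1 zero    = refl
  1^n≈1 (suc n) = trans (*-identityˡ _) (1^n≈1 n)

  ^-cancel : ∀ {x y} → x * y ≈ 1# → ∀ m n → y ^ (m ℕ.+ n) * x ^ m ≈ y ^ n
  ^-cancel {x} {y} xy≈1 m n = begin
    y ^ (m ℕ.+ n) * x ^ m      ≈⟨ *-congʳ (^-homo-* y m n) ⟩
    y ^ m * y ^ n * x ^ m      ≈⟨ solve 3 (λ a b c → a :* b :* c := c :* a :* b) refl (y ^ m) (y ^ n) (x ^ m) ⟩
    x ^ m * y ^ m * y ^ n      ≈⟨ *-congʳ (^-distrib-* x y m) ⟨
    (x * y) ^ m * y ^ n        ≈⟨ *-congʳ (trans (^-congˡ m xy≈1) (1^n≈1 m)) ⟩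
    1# * y ^ n                 ≈⟨ *-identityˡ _ ⟩
    y ^ n                      ∎

  scale-step : ∀ {a b v y} → a ≈ v * b + y * a → ∀ s → s * a ≈ s * v * b + y * (s * a)
  scale-step {a} {b} {v} {y} a≈ s = trans (*-congˡ a≈)
    (solve 5 (λ a b v y s → s :* (v :* b :+ y :* a) := s :* v :* b :+ y :* (s :* a)) refl a b v y s)

  -- As `y` is the inverse of `x`, multiplication by a power of `y` turns the factor `x ^ m` into a
  -- shift of the exponent by `m`. This is how the recurrences arise at 1 and at the other roots of
  -- unity.
  power-scale-step : ∀ {x y} → x * y ≈ 1# → ∀ {a b v} m → a ≈ v * b + x ^ m * a → ∀ n →
                     y ^ (m ℕ.+ n) * a ≈ y ^ n * a + v * (y ^ (m ℕ.+ n) * b)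
  power-scale-step {x} {y} xy≈1 {a} {b} {v} m a≈ n = begin
    y ^ (m ℕ.+ n) * a                                          ≈⟨ *-congˡ a≈ ⟩
    y ^ (m ℕ.+ n) * (v * b + x ^ m * a)                        ≈⟨ solve 5 (λ s v b x a → s :* (v :* b :+ x :* a) := s :* x :* a :+ v :* (s :* b)) refl (y ^ (m ℕ.+ n)) v b (x ^ m) a ⟩
    y ^ (m ℕ.+ n) * x ^ m * a + v * (y ^ (m ℕ.+ n) * b)        ≈⟨ +-congʳ (*-congʳ (^-cancel xy≈1 m n)) ⟩
    y ^ n * a + v * (y ^ (m ℕ.+ n) * b)                        ∎

  interchange : ∀ a b c d → (a * b) * (c * d) ≈ (a * c) * (b * d)
  interchange = solve 4 (λ a b c d → (a :* b) :* (c :* d) := (a :* c) :* (b :* d)) refl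

  product-scale : ∀ {n} x {f g : Vector Carrier n} → (∀ k → f k ≈ x * g k) → product f ≈ x ^ n * product g
  product-scale {zero}  x f≈ = sym (*-identityˡ 1#)
  product-scale {suc n} x {f} {g} f≈ = trans (*-cong (f≈ Fin.zero) (product-scale x {tail f} {tail g} (f≈ ∘ Fin.suc)))
    (interchange _ _ _ _)

  product-inverse : ∀ {n} {f g : Vector Carrier n} → (∀ k → f k * g k ≈ 1#) → product f * product g ≈ 1#
  product-inverse {zero}  fg≈1 = *-identityˡ 1#
  product-inverse {suc n} {f} {g} fg≈1 = trans (interchange _ _ _ _)
    (trans (*-cong (fg≈1 Fin.zero) (product-inverse {f = tail f} {tail g} (fg≈1 ∘ Fin.suc))) (*-identityˡ 1#))

  product-++ : ∀ {a} {A : Set a} (h : A → Carrier) {m n} (xs : Vector A m) (ys : Vector A n) →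
               product (h ∘ (xs ++ ys)) ≈ product (h ∘ xs) * product (h ∘ ys)
  product-++ h {zero}      xs ys = sym (*-identityˡ _)
  product-++ h {suc m} {n} xs ys = trans
    (*-congˡ (trans (reflexive (product-cong-≗ (λ k → ≡.cong h (shift k)))) (product-++ h (tail xs) ys)))
    (sym (*-assoc _ _ _))
    where
    shift : ∀ k → (xs ++ ys) (Fin.suc k) ≡ (tail xs ++ ys) k
    shift k = Sumₚ.[,]-map (splitAt m k)

module SumRemoval {c ℓ} (M : CommutativeMonoid c ℓ) where
  open CommutativeMonoid M
  open CommutativeMonoidSum M
  open CommutativeSemigroupProperties commutativeSemigroup using (x∙yz≈y∙xz)

  -- Used multiplicatively: the term of index `punchIn k i` contains the factor of index `k`, and
  -- without that factor it is the term of index `i` of the family from which `k` is dropped.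
  sum-removeAt-punchIn : ∀ {n} (f : Vector Carrier (suc (suc n))) k i →
                         sum (removeAt f (punchIn k i)) ≈ f k ∙ sum (removeAt (removeAt f k) i)
  sum-removeAt-punchIn         f Fin.zero    i           = refl
  sum-removeAt-punchIn         f (Fin.suc k) Fin.zero    = sum-remove {i = k} (tail f)
  sum-removeAt-punchIn {suc n} f (Fin.suc k) (Fin.suc i) =
    trans (∙-congˡ (sum-removeAt-punchIn (tail f) k i)) (x∙yz≈y∙xz _ _ _)

-- Periodic sequences

module Periodicity {c ℓ} (S : Setoid c ℓ) where
  open Setoid S

  Periodic : ℕ → (ℕ → Carrier) → Set ℓ
  Periodic x f = ∀ u → f (x ℕ.+ u) ≈ f u

  periodic-* : ∀ {x f} → Periodic x f → ∀ k → Periodic (k ℕ.* x) f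
  periodic-*         per zero    u = refl
  periodic-* {x} {f} per (suc k) u = trans (reflexive (≡.cong f (ℕₚ.+-assoc x (k ℕ.* x) u)))
    (trans (per _) (periodic-* per k u))

  -- Bézout makes 1 the difference of a multiple of `x` and a multiple of `y`, in one order or the
  -- other, so a shift by 1 is composed of shifts by periods.
  coprime-periodic : ∀ {x y f} → ℕC.Coprime x y → Periodic x f → Periodic y f → Periodic 1 f
  coprime-periodic {x} {y} {f} x⊥y x-per y-per u with ℕC.coprime-Bézout x⊥y
  ... | Bézout.+- i j 1+jy≡ix = trans (sym (periodic-* y-per j (suc u)))
    (trans (reflexive (≡.cong f (≡.trans (ℕₚ.+-suc (j ℕ.* y) u) (≡.cong (ℕ._+ u) 1+jy≡ix)))) (periodic-* x-per i u))
  ... | Bézout.-+ i j 1+ix≡jy = trans (sym (periodic-* x-per i (suc u)))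
    (trans (reflexive (≡.cong f (≡.trans (ℕₚ.+-suc (i ℕ.* x) u) (≡.cong (ℕ._+ u) 1+ix≡jy)))) (periodic-* y-per j u))

  periodic-≈ : ∀ {x f g} .{{_ : NonZero x}} → Periodic x f → Periodic x g → (∀ {u} → u ℕ.< x → f u ≈ g u) → ∀ u → f u ≈ g u
  periodic-≈ {x} {f} {g} f-per g-per f≈g u =
    trans (reduce f f-per) (trans (f≈g (m%n<n u x)) (sym (reduce g g-per)))
    where
    reduce : ∀ h → Periodic x h → h u ≈ h (u ℕ.% x)
    reduce h h-per = trans
      (reflexive (≡.cong h (≡.trans (m≡m%n+[m/n]*n u x) (ℕₚ.+-comm (u ℕ.% x) _))))
      (periodic-* h-per (u ℕ./ x) (u ℕ.% x))

-- The commutative semiring of formal power series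

module SeriesSemiring {c ℓ₁ ℓ₂} (K : HeytingField c ℓ₁ ℓ₂) where
  open HeytingFieldArithmetic K
  open ExpansionAt1 K
  open SemiringSum semiring using (*-distribˡ-sum)
  open ≈-Reasoning setoid
  open SemiringSolver commutativeSemiring using (solve; _:=_; _:+_; _:*_; con)

  tl : Series → Series
  tl f = f ∘ suc

  *ˢ-cong : ∀ {f f′ g g′} → f ≋ f′ → g ≋ g′ → f *ˢ g ≋ f′ *ˢ g′
  *ˢ-cong f≋f′ g≋g′ n = sum-cong {suc n} λ i → *-cong (f≋f′ (toℕ i)) (g≋g′ (n ℕ.∸ toℕ i))

  *ˢ-zeroˡ : ∀ f → 0ˢ *ˢ f ≋ 0ˢ
  *ˢ-zeroˡ f n = sum-0 {suc n} _ λ i → zeroˡ (f (n ℕ.∸ toℕ i))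

  *ˢ-identityˡ : ∀ f → 1ˢ *ˢ f ≋ f
  *ˢ-identityˡ f zero    = trans (+-identityʳ _) (*-identityˡ _)
  *ˢ-identityˡ f (suc n) = trans (+-cong (*-identityˡ _) (*ˢ-zeroˡ f n)) (+-identityʳ _)

  *ˢ-distribʳ : ∀ f g h → (g +ˢ h) *ˢ f ≋ g *ˢ f +ˢ h *ˢ f
  *ˢ-distribʳ f g h zero = solve 3 (λ f g h → (g :+ h) :* f :+ con 0 := (g :* f :+ con 0) :+ (h :* f :+ con 0)) refl (f 0) (g 0) (h 0)
  *ˢ-distribʳ f g h (suc n) = begin
    (g 0 + h 0) * f (suc n) + ((tl g +ˢ tl h) *ˢ f) n
      ≈⟨ +-congˡ (*ˢ-distribʳ f (tl g) (tl h) n) ⟩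
    (g 0 + h 0) * f (suc n) + ((tl g *ˢ f) n + (tl h *ˢ f) n)
      ≈⟨ solve 5 (λ f g h a b → (g :+ h) :* f :+ (a :+ b) := (g :* f :+ a) :+ (h :* f :+ b)) refl
           (f (suc n)) (g 0) (h 0) ((tl g *ˢ f) n) ((tl h *ˢ f) n) ⟩
    _ ∎

  *ˢ-scaleˡ : ∀ x f g n → ((λ k → x * f k) *ˢ g) n ≈ x * (f *ˢ g) n
  *ˢ-scaleˡ x f g n = trans (sum-cong {suc n} λ i → *-assoc x (f (toℕ i)) (g (n ℕ.∸ toℕ i)))
    (sym (*-distribˡ-sum {suc n} x λ i → f (toℕ i) * g (n ℕ.∸ toℕ i)))

  *ˢ-assoc : ∀ f g h → (f *ˢ g) *ˢ h ≋ f *ˢ (g *ˢ h)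
  *ˢ-assoc f g h zero = solve 3 (λ f g h → (f :* g :+ con 0) :* h :+ con 0 := f :* (g :* h :+ con 0) :+ con 0) refl (f 0) (g 0) (h 0)
  *ˢ-assoc f g h (suc n) = begin
    -- By definition the tail of `f *ˢ g` is `f 0` times the tail of `g`, plus `tl f *ˢ g`.
    (f *ˢ g) 0 * h (suc n) + (((λ k → f 0 * g (suc k)) +ˢ tl f *ˢ g) *ˢ h) n
      ≈⟨ +-congˡ (*ˢ-distribʳ h (λ k → f 0 * g (suc k)) (tl f *ˢ g) n) ⟩
    (f *ˢ g) 0 * h (suc n) + (((λ k → f 0 * g (suc k)) *ˢ h) n + ((tl f *ˢ g) *ˢ h) n)
      ≈⟨ +-congˡ (+-cong (*ˢ-scaleˡ (f 0) (tl g) h n) (*ˢ-assoc (tl f) g h n)) ⟩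
    (f 0 * g 0 + 0#) * h (suc n) + (f 0 * (tl g *ˢ h) n + (tl f *ˢ (g *ˢ h)) n)
      ≈⟨ solve 5 (λ f g h a b → (f :* g :+ con 0) :* h :+ (f :* a :+ b) := f :* (g :* h :+ a) :+ b) refl
           (f 0) (g 0) (h (suc n)) ((tl g *ˢ h) n) ((tl f *ˢ (g *ˢ h)) n) ⟩
    f 0 * (g 0 * h (suc n) + (tl g *ˢ h) n) + (tl f *ˢ (g *ˢ h)) n ∎

  -- A product splits off its first summand by definition; this is the mirror image, and
  -- commutativity follows by comparing the two.
  *ˢ-last : ∀ f g n → (f *ˢ g) (suc n) ≈ (f *ˢ tl g) n + f (suc n) * g 0
  *ˢ-last f g zero    = solve 2 (λ a b → a :+ (b :+ con 0) := a :+ con 0 :+ b) refl (f 0 * g 1) (f 1 * g 0)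
  *ˢ-last f g (suc n) = trans (+-congˡ (*ˢ-last (tl f) g n)) (sym (+-assoc _ _ _))

  *ˢ-comm : ∀ f g → f *ˢ g ≋ g *ˢ f
  *ˢ-comm f g zero    = +-congʳ (*-comm _ _)
  *ˢ-comm f g (suc n) = begin
    f 0 * g (suc n) + (tl f *ˢ g) n  ≈⟨ +-cong (*-comm _ _) (*ˢ-comm (tl f) g n) ⟩
    g (suc n) * f 0 + (g *ˢ tl f) n  ≈⟨ +-comm _ _ ⟩
    (g *ˢ tl f) n + g (suc n) * f 0  ≈⟨ *ˢ-last g f n ⟨
    (g *ˢ f) (suc n)                 ∎

  ≋-isEquivalence : IsEquivalence _≋_
  ≋-isEquivalence = record
    { refl  = λ n → refl
    ; sym   = λ f≋g n → sym (f≋g n)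
    ; trans = λ f≋g g≋h n → trans (f≋g n) (g≋h n)
    }

  seriesSemiring : CommutativeSemiring c ℓ₁
  seriesSemiring = record
    { Carrier = Series ; _≈_ = _≋_ ; _+_ = _+ˢ_ ; _*_ = _*ˢ_ ; 0# = 0ˢ ; 1# = 1ˢ
    ; isCommutativeSemiring = isCommutativeSemiringˡ record
      { +-isCommutativeMonoid = isCommutativeMonoidˡ record
        { isSemigroup = record
          { isMagma = record
            { isEquivalence = ≋-isEquivalence
            ; ∙-cong        = λ f≋f′ g≋g′ n → +-cong (f≋f′ n) (g≋g′ n)
            }
          ; assoc   = λ f g h n → +-assoc (f n) (g n) (h n)
          }
        ; identityˡ   = λ f n → +-identityˡ (f n)
        ; comm        = λ f g n → +-comm (f n) (g n)
        }
      ; *-isCommutativeMonoid = isCommutativeMonoidˡ record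
        { isSemigroup = record
          { isMagma = record { isEquivalence = ≋-isEquivalence ; ∙-cong = *ˢ-cong }
          ; assoc   = *ˢ-assoc
          }
        ; identityˡ   = *ˢ-identityˡ
        ; comm        = *ˢ-comm
        }
      ; distribʳ = *ˢ-distribʳ
      ; zeroˡ    = *ˢ-zeroˡ
      }
    }
    where open import Algebra.Structures.Biased _≋_

  open CommutativeSemiring seriesSemiring public
    using () renaming (trans to ≋-trans; *-identityʳ to *ˢ-identityʳ)

-- Polynomials and geometric sums over a Heyting field

module FieldProperties {c ℓ₁ ℓ₂} (K : HeytingField c ℓ₁ ℓ₂) where
  open HeytingFieldArithmetic K
  open SemiringSum semiring using (*-distribˡ-sum; sum-remove; sum-replicate)
  open SemiringSolver commutativeSemiring using (solve; _:=_; _:+_; _:*_; con)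
  open AbelianGroupProperties +-abelianGroup using () renaming (⁻¹-∙-comm to -x-y≈-[x+y])
  open CommutativeSemigroupProperties (CommutativeMonoid.commutativeSemigroup (CommutativeRing.+-commutativeMonoid commutativeRing))
    using () renaming (interchange to +-interchange)
  open ≈-Reasoning setoid

  y-x+x≈y : ∀ x y → (y - x) + x ≈ y
  y-x+x≈y x y = trans (+-assoc y (- x) x) (trans (+-congˡ (-‿inverseˡ x)) (+-identityʳ y))

  x-y≈0⇒x≈y : ∀ {x y} → x - y ≈ 0# → x ≈ y
  x-y≈0⇒x≈y {x} {y} x-y≈0 = trans (sym (y-x+x≈y y x)) (trans (+-congʳ x-y≈0) (+-identityˡ y))

  x≈y⇒x-y≈0 : ∀ {x y} → x ≈ y → x - y ≈ 0#
  x≈y⇒x-y≈0 {x} {y} x≈y = trans (+-congʳ x≈y) (-‿inverseʳ y)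

  +-cancelʳ : ∀ {x y} z → x + z ≈ y + z → x ≈ y
  +-cancelʳ {x} {y} z eq = begin
    x            ≈⟨ lem x ⟨
    x + z - z    ≈⟨ +-congʳ eq ⟩
    y + z - z    ≈⟨ lem y ⟩
    y            ∎
    where
    lem : ∀ w → w + z - z ≈ w
    lem w = trans (+-assoc w z (- z)) (trans (+-congˡ (-‿inverseʳ z)) (+-identityʳ w))

  [a+b]-[c+d] : ∀ a b c d → (a + b) - (c + d) ≈ (a - c) + (b - d)
  [a+b]-[c+d] a b c d = trans (+-congˡ (sym (-x-y≈-[x+y] c d))) (+-interchange a b (- c) (- d))

  #0-cancelˡ : ∀ {x y} → x # 0# → x * y ≈ 0# → y ≈ 0#
  #0-cancelˡ {x} {y} x#0 xy≈0 = begin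
    y                   ≈⟨ *-identityˡ y ⟨
    1# * y              ≈⟨ *-congʳ (trans (*-comm _ _) (inverseʳ x#0)) ⟨
    inv x x#0 * x * y   ≈⟨ *-assoc _ x y ⟩
    inv x x#0 * (x * y) ≈⟨ *-congˡ xy≈0 ⟩
    inv x x#0 * 0#      ≈⟨ zeroʳ _ ⟩
    0#                  ∎

  inverse-unique : ∀ {x y z} → x * y ≈ 1# → x * z ≈ 1# → y ≈ z
  inverse-unique {x} {y} {z} xy≈1 xz≈1 = begin
    y            ≈⟨ *-identityʳ y ⟨
    y * 1#       ≈⟨ *-congˡ xz≈1 ⟨
    y * (x * z)  ≈⟨ solve 3 (λ x y z → y :* (x :* z) := x :* y :* z) refl x y z ⟩
    x * y * z    ≈⟨ *-congʳ xy≈1 ⟩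
    1# * z       ≈⟨ *-identityˡ z ⟩
    z            ∎

  -#0⇒# : ∀ {x y} → x - y # 0# → x # y
  -#0⇒# x-y#0 = invertibleʳ⇒# (inv _ x-y#0 , inverseʳ x-y#0)

  sum-single : ∀ {n} (f : Vector Carrier n) j → (∀ i → i ≢ j → f i ≈ 0#) → sum f ≈ f j
  sum-single {suc n} f j f≈0 = begin
    sum f                      ≈⟨ sum-remove {i = j} f ⟩
    f j + sum (removeAt f j)   ≈⟨ +-congˡ (sum-0 (removeAt f j) λ i → f≈0 (punchIn j i) (punchInᵢ≢i j i)) ⟩
    f j + 0#                   ≈⟨ +-identityʳ _ ⟩
    f j                        ∎

  eval : ∀ {n} → Vector Carrier n → Carrier → Carrier
  eval f x = sum λ k → f k * x ^ toℕ k

  eval-suc : ∀ {n} (f : Vector Carrier (suc n)) x → eval f x ≈ f Fin.zero + x * eval (tail f) x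
  eval-suc {n} f x = +-cong (*-identityʳ _) (begin
    sum (λ k → f (Fin.suc k) * (x * x ^ toℕ k))
      ≈⟨ sum-cong {n} (λ k → solve 3 (λ a b c → a :* (b :* c) := b :* (a :* c)) refl (f (Fin.suc k)) x (x ^ toℕ k)) ⟩
    sum (λ k → x * (f (Fin.suc k) * x ^ toℕ k))
      ≈⟨ *-distribˡ-sum {n} x (λ k → f (Fin.suc k) * x ^ toℕ k) ⟨
    x * eval (tail f) x ∎)

  -- The quotient of f by X - p.
  divide : ∀ {n} → Vector Carrier (suc n) → Carrier → Vector Carrier n
  divide {suc n} f p Fin.zero    = eval (tail f) p
  divide {suc n} f p (Fin.suc k) = divide (tail f) p k

  eval-divide : ∀ {n} (f : Vector Carrier (suc n)) x p → eval f x - eval f p ≈ (x - p) * eval (divide f p) x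
  eval-divide {zero} f x p = begin
    eval f x - eval f p  ≈⟨ -‿inverseʳ _ ⟩
    0#                   ≈⟨ zeroʳ _ ⟨
    (x - p) * 0#         ∎
  -- With `eval f p` added to both sides, and with `x` and `e` rewritten as a difference plus its
  -- subtrahend, the semiring solver applies although it knows no subtraction.
  eval-divide {suc n} f x p = +-cancelʳ (eval f p) (begin
    eval f x - eval f p + eval f p
      ≈⟨ y-x+x≈y _ _ ⟩
    eval f x
      ≈⟨ eval-suc f x ⟩
    f₀ + x * e
      ≈⟨ +-cong refl (*-cong (y-x+x≈y p x) (y-x+x≈y e′ e)) ⟨
    f₀ + (d + p) * ((e - e′) + e′)
      ≈⟨ +-congˡ (*-congˡ (+-congʳ (eval-divide (tail f) x p))) ⟩
    f₀ + (d + p) * (d * g + e′)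
      ≈⟨ solve 5 (λ f d p g e → f :+ (d :+ p) :* (d :* g :+ e) := d :* (e :+ (d :+ p) :* g) :+ (f :+ p :* e)) refl f₀ d p g e′ ⟩
    d * (e′ + (d + p) * g) + (f₀ + p * e′)
      ≈⟨ +-cong (*-congˡ (+-congˡ (*-congʳ (y-x+x≈y p x)))) (sym (eval-suc f p)) ⟩
    d * (e′ + x * g) + eval f p
      ≈⟨ +-congʳ (*-congˡ (eval-suc (divide f p) x)) ⟨
    d * eval (divide f p) x + eval f p ∎)
    where
    f₀ = f Fin.zero
    d  = x - p
    e  = eval (tail f) x
    e′ = eval (tail f) p
    g  = eval (divide (tail f) p) x

  eval-0 : ∀ {n} (f : Vector Carrier n) x → (∀ k → f k ≈ 0#) → eval f x ≈ 0#
  eval-0 {n} f x f≈0 = sum-0 {n} _ λ k → trans (*-congʳ {x ^ toℕ k} (f≈0 k)) (zeroˡ (x ^ toℕ k))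

  -- The lowest coefficient of the quotient is the value of `tail f` at `p`. Once the coefficients
  -- above degree 1 are known to be 0, this value is the coefficient of degree 1.
  divide≈0 : ∀ {n} (f : Vector Carrier (suc n)) p → (∀ k → divide f p k ≈ 0#) → ∀ k → f (Fin.suc k) ≈ 0#
  divide≈0 {suc n} f p q≈0 Fin.zero    = begin
    f (Fin.suc Fin.zero)                                     ≈⟨ +-identityʳ _ ⟨
    f (Fin.suc Fin.zero) + 0#                                ≈⟨ +-congˡ (trans (*-congˡ (eval-0 _ p (divide≈0 (tail f) p (q≈0 ∘ Fin.suc)))) (zeroʳ p)) ⟨
    f (Fin.suc Fin.zero) + p * eval (tail (tail f)) p        ≈⟨ eval-suc (tail f) p ⟨
    eval (tail f) p                                          ≈⟨ q≈0 Fin.zero ⟩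
    0#                                                       ∎
  divide≈0 {suc n} f p q≈0 (Fin.suc k) = divide≈0 (tail f) p (q≈0 ∘ Fin.suc) k

  -- Division by X - `p₀` keeps the other points as zeros, because apartness allows `p i - p₀` to be
  -- cancelled. By induction the quotient is 0, so only the constant coefficient is left, and any
  -- zero kills it.
  vanishing-polynomial : ∀ {n} (f p : Vector Carrier n) → (∀ {i j} → i ≢ j → p i # p j) →
                         (∀ i → eval f (p i) ≈ 0#) → ∀ k → f k ≈ 0#
  vanishing-polynomial {suc n} f p apart zeros = λ where
      Fin.zero    → begin
        f Fin.zero                            ≈⟨ +-identityʳ _ ⟨
        f Fin.zero + 0#                       ≈⟨ +-congˡ (trans (*-congˡ (eval-0 _ p₀ tail≈0)) (zeroʳ p₀)) ⟨
        f Fin.zero + p₀ * eval (tail f) p₀    ≈⟨ eval-suc f p₀ ⟨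
        eval f p₀                             ≈⟨ zeros Fin.zero ⟩
        0#                                    ∎
      (Fin.suc k) → tail≈0 k
    where
    p₀ = p Fin.zero

    tail≈0 : ∀ k → f (Fin.suc k) ≈ 0#
    tail≈0 = divide≈0 f p₀ (vanishing-polynomial (divide f p₀) (tail p) (λ i≢j → apart λ { ≡.refl → i≢j ≡.refl })
      λ i → #0-cancelˡ (#⇒-#0 (apart {Fin.suc i} {Fin.zero} λ ()))
        (trans (sym (eval-divide f (p (Fin.suc i)) p₀)) (trans (+-cong (zeros (Fin.suc i)) (-‿cong (zeros Fin.zero))) (-‿inverseʳ 0#))))

  geometric : ℕ → Carrier → Carrier
  geometric d y = eval {d} (λ _ → 1#) y

  geometric-1 : ∀ d {y} → y ≈ 1# → geometric d y ≈ d · 1#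
  geometric-1 d {y} y≈1 = trans
    (sum-cong {d} {ys = λ _ → 1#} λ k → trans (*-identityˡ _) (trans (^-congˡ (toℕ k) y≈1) (1^n≈1 (toℕ k))))
    (sum-replicate d)

  1+y*geometric : ∀ d y → geometric d y + y ^ d ≈ 1# + y * geometric d y
  1+y*geometric zero    y = trans (+-comm 0# 1#) (+-congˡ (sym (zeroʳ y)))
  1+y*geometric (suc d) y = begin
    geometric (suc d) y + y * y ^ d          ≈⟨ +-congʳ (eval-suc {d} (λ _ → 1#) y) ⟩
    1# + y * geometric d y + y * y ^ d       ≈⟨ solve 3 (λ y g h → con 1 :+ y :* g :+ y :* h := con 1 :+ y :* (g :+ h)) refl y (geometric d y) (y ^ d) ⟩
    1# + y * (geometric d y + y ^ d)         ≈⟨ +-congˡ (*-congˡ (1+y*geometric d y)) ⟩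
    1# + y * (1# + y * geometric d y)        ≈⟨ +-congˡ (*-congˡ (eval-suc {d} (λ _ → 1#) y)) ⟨
    1# + y * geometric (suc d) y             ∎

  root-geometric : ∀ d {y} → y ^ d ≈ 1# → (y - 1#) * geometric d y ≈ 0#
  root-geometric d {y} y^d≈1 = +-cancelʳ (geometric d y) (begin
    (y - 1#) * geometric d y + geometric d y  ≈⟨ solve 2 (λ z g → z :* g :+ g := (z :+ con 1) :* g) refl (y - 1#) (geometric d y) ⟩
    (y - 1# + 1#) * geometric d y             ≈⟨ *-congʳ (y-x+x≈y 1# y) ⟩
    y * geometric d y                         ≈⟨ +-cancelʳ 1# (begin
      y * geometric d y + 1#                  ≈⟨ +-comm _ _ ⟩
      1# + y * geometric d y                  ≈⟨ 1+y*geometric d y ⟨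
      geometric d y + y ^ d                   ≈⟨ +-congˡ y^d≈1 ⟩
      geometric d y + 1#                      ∎) ⟩
    geometric d y                             ≈⟨ +-identityˡ _ ⟨
    0# + geometric d y                        ∎)

  root-geometric-0 : ∀ d {y} → y ^ d ≈ 1# → y # 1# → geometric d y ≈ 0#
  root-geometric-0 d y^d≈1 y#1 = #0-cancelˡ (#⇒-#0 y#1) (root-geometric d y^d≈1)

  -- 1 + y + ⋯ + y^(d-1) cannot be close both to 0 and to its value d at y = 1.
  root-≈1⊎#1 : ∀ d → d · 1# # 0# → ∀ {y} → y ^ d ≈ 1# → y ≈ 1# ⊎ y # 1#
  root-≈1⊎#1 zero    0#0 = ⊥-elim (#-irrefl refl 0#0)
  root-≈1⊎#1 (suc d) d#0 {y} y^d≈1 with #-cotrans d#0 (geometric (suc d) y)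
  ... | inj₂ g#0 = inj₁ (x-y≈0⇒x≈y (#0-cancelˡ g#0 (trans (*-comm _ _) (root-geometric (suc d) y^d≈1))))
  ... | inj₁ d#g = inj₂ (-#0⇒# (*-#0ˡ (#-congʳ (begin
    geometric (suc d) y - suc d · 1#         ≈⟨ +-congˡ (-‿cong (geometric-1 (suc d) refl)) ⟨
    geometric (suc d) y - geometric (suc d) 1#  ≈⟨ eval-divide {d} (λ _ → 1#) y 1# ⟩
    (y - 1#) * _                             ∎) (#⇒-#0 (#-sym d#g)))))

-- Sums over roots of unity

module RootSums {c ℓ₁ ℓ₂} (K : HeytingField c ℓ₁ ℓ₂) (char0 : CharacteristicZero K) where
  open HeytingFieldArithmetic K
  open RootsOfUnity K
  open FourierDedekind K char0 using (n·1#0)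
  open FieldProperties K
  open SumRemoval (CommutativeRing.*-commutativeMonoid commutativeRing) using () renaming (sum-removeAt-punchIn to product-removeAt-punchIn)
  open SemiringSum semiring using (*-distribʳ-sum; ∑-comm; ∑-distrib-+; sum-remove; sum-replicate)
  open SemiringIdentities commutativeSemiring using (reciprocal-step; power-step; product-step; power-scale-step)
  open ≈-Reasoning setoid

  -- Bundling a number with the enumeration of its roots makes a family an ordinary vector, from
  -- which `removeAt` drops both together.
  record Modulus : Set (c ⊔ ℓ₁ ⊔ ℓ₂) where
    field
      modulus : ℕ
      nonZero : NonZero modulus
      roots   : NontrivialRootsOfUnity modulus

    root : Fin (modulus ℕ.∸ 1) → NontrivialRoot modulus
    root = Bijection.to roots

  open Modulus

  root⁻¹ : ∀ {d} .{{_ : NonZero d}} → NontrivialRoot d → Carrier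
  root⁻¹ = value ∘ inverseRoot

  value*root⁻¹ : ∀ {d} .{{_ : NonZero d}} (ζ : NontrivialRoot d) → value ζ * root⁻¹ ζ ≈ 1#
  value*root⁻¹ ζ = inverseʳ (root#0 ζ)

  root⁻¹^d : ∀ {d} .{{_ : NonZero d}} (ζ : NontrivialRoot d) → root⁻¹ ζ ^ d ≈ 1#
  root⁻¹^d = value^d ∘ inverseRoot

  [x^k]^d≈1 : ∀ {x d} k → x ^ d ≈ 1# → (x ^ k) ^ d ≈ 1#
  [x^k]^d≈1 {x} {d} k x^d≈1 = begin
    (x ^ k) ^ d    ≈⟨ ^-assocʳ x k d ⟩
    x ^ (k ℕ.* d)  ≈⟨ ^-congʳ x (ℕₚ.*-comm k d) ⟩
    x ^ (d ℕ.* k)  ≈⟨ ^-assocʳ x d k ⟨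
    (x ^ d) ^ k    ≈⟨ ^-congˡ k x^d≈1 ⟩
    1# ^ k         ≈⟨ 1^n≈1 k ⟩
    1#             ∎

  module Orthogonality (d : ℕ) (roots : NontrivialRootsOfUnity (suc d)) where

    X Y : Vector Carrier (suc d)
    X Fin.zero    = 1#
    X (Fin.suc i) = value (Bijection.to roots i)
    Y Fin.zero    = 1#
    Y (Fin.suc i) = root⁻¹ (Bijection.to roots i)

    X^ : ∀ i → X i ^ suc d ≈ 1#
    X^ Fin.zero    = 1^n≈1 (suc d)
    X^ (Fin.suc i) = value^d (Bijection.to roots i)

    Y^ : ∀ i → Y i ^ suc d ≈ 1#
    Y^ Fin.zero    = 1^n≈1 (suc d)
    Y^ (Fin.suc i) = root⁻¹^d (Bijection.to roots i)

    XY≈1 : ∀ i → X i * Y i ≈ 1#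
    XY≈1 Fin.zero    = *-identityˡ 1#
    XY≈1 (Fin.suc i) = value*root⁻¹ (Bijection.to roots i)

    [YX]^ : ∀ i j → (Y i * X j) ^ suc d ≈ 1#
    [YX]^ i j = begin
      (Y i * X j) ^ suc d        ≈⟨ ^-distrib-* (Y i) (X j) (suc d) ⟩
      Y i ^ suc d * X j ^ suc d  ≈⟨ *-cong (Y^ i) (X^ j) ⟩
      1# * 1#                    ≈⟨ *-identityˡ 1# ⟩
      1#                         ∎

    X-injective : ∀ i j → X i ≈ X j → i ≡ j
    X-injective Fin.zero    Fin.zero    _  = ≡.refl
    X-injective Fin.zero    (Fin.suc j) eq = ⊥-elim (#-irrefl (sym eq) (value#1 (Bijection.to roots j)))
    X-injective (Fin.suc i) Fin.zero    eq = ⊥-elim (#-irrefl eq (value#1 (Bijection.to roots i)))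
    X-injective (Fin.suc i) (Fin.suc j) eq = ≡.cong Fin.suc (Bijection.injective roots eq)

    X*[YX] : ∀ i j → X i * (Y i * X j) ≈ X j
    X*[YX] i j = trans (sym (*-assoc _ _ _)) (trans (*-congʳ (XY≈1 i)) (*-identityˡ (X j)))

    -- Distinct indices give only inequality, while the polynomial argument needs apartness. A
    -- quotient of two roots is again a root, and a root is either equal to 1 or apart from it.
    YX#1 : ∀ {i j} → i ≢ j → Y i * X j # 1#
    YX#1 {i} {j} i≢j with root-≈1⊎#1 (suc d) (char0 d) ([YX]^ i j)
    ... | inj₂ #1 = #1
    ... | inj₁ ≈1 = ⊥-elim (i≢j (X-injective i j (begin
      X i                ≈⟨ *-identityʳ _ ⟨
      X i * 1#           ≈⟨ *-congˡ ≈1 ⟨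
      X i * (Y i * X j)  ≈⟨ X*[YX] i j ⟩
      X j                ∎)))

    X-apart : ∀ {i j} → i ≢ j → X i # X j
    X-apart {i} {j} i≢j = #-sym (*-strongˡ {Y i} (#-congˡ (sym (trans (*-comm _ _) (XY≈1 i))) (YX#1 i≢j)))

    powerSum : ℕ → Carrier
    powerSum k = sum λ i → Y i ^ k

    powerSum-0 : powerSum 0 ≈ suc d · 1#
    powerSum-0 = sum-replicate (suc d)

    powerSum-+ : ∀ k → powerSum (suc d ℕ.+ k) ≈ powerSum k
    powerSum-+ k = sum-cong λ i → trans (^-homo-* (Y i) (suc d) k) (trans (*-congʳ (Y^ i)) (*-identityˡ _))

    -- After the interchange of the sums, the inner one is a geometric sum in `Y i * X j`: it is 0
    -- unless `i` = `j`, when all its terms are 1.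
    eval-powerSum : ∀ j → eval {suc d} (powerSum ∘ toℕ) (X j) ≈ suc d · 1#
    eval-powerSum j = begin
      sum {suc d} (λ k → powerSum (toℕ k) * X j ^ toℕ k)
        ≈⟨ sum-cong {suc d} (λ k → *-distribʳ-sum {suc d} (X j ^ toℕ k) (λ i → Y i ^ toℕ k)) ⟩
      sum {suc d} (λ k → sum {suc d} λ i → Y i ^ toℕ k * X j ^ toℕ k)
        ≈⟨ sum-cong {suc d} (λ k → sum-cong {suc d} λ i →
             trans (sym (^-distrib-* (Y i) (X j) (toℕ k))) (sym (*-identityˡ ((Y i * X j) ^ toℕ k)))) ⟩
      sum {suc d} (λ k → sum {suc d} λ i → 1# * (Y i * X j) ^ toℕ k)
        ≈⟨ ∑-comm {suc d} {suc d} (λ k i → 1# * (Y i * X j) ^ toℕ k) ⟩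
      sum {suc d} (λ i → geometric (suc d) (Y i * X j))
        ≈⟨ sum-single (λ i → geometric (suc d) (Y i * X j)) j
             (λ i i≢j → root-geometric-0 (suc d) ([YX]^ i j) (YX#1 i≢j)) ⟩
      geometric (suc d) (Y j * X j)
        ≈⟨ geometric-1 (suc d) (trans (*-comm _ _) (XY≈1 j)) ⟩
      suc d · 1# ∎

    -- The polynomial whose coefficients are the power sums takes the value `suc d` at all the
    -- `suc d` roots. Subtracting this constant leaves degree at most `d` and too many zeros.
    powerSum≈0 : ∀ (k : Fin d) → powerSum (suc (toℕ k)) ≈ 0#
    powerSum≈0 k = trans (sym (+-identityʳ _)) (trans (+-congˡ (sym -0#≈0#))
        (vanishing-polynomial {suc d} f X X-apart zeros (Fin.suc k)))
      where
      δ : Vector Carrier (suc d)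
      δ Fin.zero    = suc d · 1#
      δ (Fin.suc k) = 0#

      f : Vector Carrier (suc d)
      f i = powerSum (toℕ i) - δ i

      eval-δ : ∀ x → eval δ x ≈ suc d · 1#
      eval-δ x = trans (eval-suc δ x) (trans (+-congˡ (trans (*-congˡ (eval-0 (tail δ) x λ _ → refl)) (zeroʳ x))) (+-identityʳ _))

      zeros : ∀ j → eval f (X j) ≈ 0#
      zeros j = +-cancelʳ (suc d · 1#) (begin
        eval f (X j) + suc d · 1#
          ≈⟨ +-congˡ (eval-δ (X j)) ⟨
        eval f (X j) + eval δ (X j)
          ≈⟨ ∑-distrib-+ {suc d} (λ k → f k * X j ^ toℕ k) (λ k → δ k * X j ^ toℕ k) ⟨
        sum {suc d} (λ k → f k * X j ^ toℕ k + δ k * X j ^ toℕ k)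
          ≈⟨ sum-cong {suc d} (λ k → trans (sym (distribʳ (X j ^ toℕ k) (f k) (δ k))) (*-congʳ (y-x+x≈y (δ k) (powerSum (toℕ k))))) ⟩
        eval {suc d} (powerSum ∘ toℕ) (X j)
          ≈⟨ eval-powerSum j ⟩
        suc d · 1#
          ≈⟨ +-identityˡ _ ⟨
        0# + suc d · 1# ∎)

  -- Total, with default 0, so that weights can be written down without proofs of coprimality; a
  -- step that uses the inverse has to supply `y # 1#`.
  inv[1-_] : ∀ {y} → y ≈ 1# ⊎ y # 1# → Carrier
  inv[1- inj₁ _   ] = 0#
  inv[1- inj₂ y#1 ] = inv _ (#⇒-#0 (#-sym y#1))

  inv[1-]-inverse : ∀ {y} (y? : y ≈ 1# ⊎ y # 1#) → y # 1# → (1# - y) * inv[1- y? ] ≈ 1#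
  inv[1-]-inverse (inj₁ y≈1) y#1 = ⊥-elim (#-irrefl y≈1 y#1)
  inv[1-]-inverse (inj₂ y#1) _   = inverseʳ (#⇒-#0 (#-sym y#1))

  module _ (m : Modulus) where
    private
      instance
        _ = nonZero m

    ω ω⁻¹ : Vector Carrier (modulus m ℕ.∸ 1)
    ω   = value ∘ root m
    ω⁻¹ = root⁻¹ ∘ root m

    ω*ω⁻¹ : ∀ i → ω i * ω⁻¹ i ≈ 1#
    ω*ω⁻¹ i = value*root⁻¹ (root m i)

    ω⁻¹^modulus : ∀ i → ω⁻¹ i ^ modulus m ≈ 1#
    ω⁻¹^modulus i = root⁻¹^d (root m i)

    modulus⁻¹ : Carrier
    modulus⁻¹ = inv (modulus m · 1#) (n·1#0 (modulus m))

    -- 1 / (1 - ω^x), or 0 if ω^x = 1.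
    κ : Fin (modulus m ℕ.∸ 1) → ℕ → Carrier
    κ i x = inv[1- root-≈1⊎#1 (modulus m) (n·1#0 (modulus m)) {ω i ^ x}
                     ([x^k]^d≈1 {ω i} {modulus m} x (value^d (root m i))) ]

    κ-inverse : ∀ i x → ω i ^ x # 1# → (1# - ω i ^ x) * κ i x ≈ 1#
    κ-inverse i x = inv[1-]-inverse (root-≈1⊎#1 (modulus m) (n·1#0 (modulus m)) {ω i ^ x}
                     ([x^k]^d≈1 {ω i} {modulus m} x (value^d (root m i))))

    κ-step : ∀ i x → ω i ^ x # 1# → κ i x ≈ 1# + ω i ^ x * κ i x
    κ-step i x x#1 = reciprocal-step (κ-inverse i x x#1)
      (trans (sym (y-x+x≈y (ω i ^ x) 1#)) (trans (+-comm _ _) (+-congˡ (sym (*-identityˡ _)))))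

    -- 1 / ((1 - ω)^r ∏ₖ (1 - ω^bₖ)); the factors 1 - ω^bₖ, where σ has ω^bₖ - 1,
    -- absorb the sign (-1)^n.
    weight : ℕ → ∀ {n} → Vector Modulus n → Vector Carrier (modulus m ℕ.∸ 1)
    weight r b i = κ i 1 ^ r * product (κ i ∘ modulus ∘ b)

    weight-suc : ∀ r {n} (b : Vector Modulus n) i → weight (suc r) b i ≈ 1# * weight r b i + ω i ^ 1 * weight (suc r) b i
    weight-suc r b i = power-step (κ-step i 1 (#-congʳ (sym (*-identityʳ _)) (value#1 (root m i)))) r _

    -- (1/d) ∑ ω^(1-u) W(ω), over the nontrivial d-th roots of unity ω
    rootSum : Vector Carrier (modulus m ℕ.∸ 1) → ℕ → Carrier
    rootSum W u = modulus⁻¹ * sum λ i → ω i * (ω⁻¹ i ^ u * W i)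

    rootSum-periodic : ∀ W u → rootSum W (modulus m ℕ.+ u) ≈ rootSum W u
    rootSum-periodic W u = *-congˡ (sum-cong λ i → *-congˡ {ω i} (*-congʳ {W i} (begin
      ω⁻¹ i ^ (modulus m ℕ.+ u)       ≈⟨ ^-homo-* (ω⁻¹ i) (modulus m) u ⟩
      ω⁻¹ i ^ modulus m * ω⁻¹ i ^ u   ≈⟨ *-congʳ (ω⁻¹^modulus i) ⟩
      1# * ω⁻¹ i ^ u                  ≈⟨ *-identityˡ _ ⟩
      ω⁻¹ i ^ u                       ∎)))

    -- Multiplying `W` = `W′` + ω^x `W` by ω^(1-(x+u)) gives the recurrence summand by summand.
    rootSum-step : ∀ x {W W′} → (∀ i → W i ≈ 1# * W′ i + ω i ^ x * W i) →
                   ∀ u → rootSum W (x ℕ.+ u) ≈ rootSum W u + rootSum W′ (x ℕ.+ u)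
    rootSum-step x {W} {W′} W≈ u = begin
      modulus⁻¹ * sum (λ i → ω i * (ω⁻¹ i ^ (x ℕ.+ u) * W i))
        ≈⟨ *-congˡ (sum-cong λ i → trans
             (*-congˡ {ω i} (trans (power-scale-step (ω*ω⁻¹ i) x (W≈ i) u) (+-congˡ (*-identityˡ _))))
             (distribˡ (ω i) (ω⁻¹ i ^ u * W i) (ω⁻¹ i ^ (x ℕ.+ u) * W′ i))) ⟩
      modulus⁻¹ * sum (λ i → ω i * (ω⁻¹ i ^ u * W i) + ω i * (ω⁻¹ i ^ (x ℕ.+ u) * W′ i))
        ≈⟨ *-congˡ (∑-distrib-+ (λ i → ω i * (ω⁻¹ i ^ u * W i)) (λ i → ω i * (ω⁻¹ i ^ (x ℕ.+ u) * W′ i))) ⟩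
      modulus⁻¹ * (sum (λ i → ω i * (ω⁻¹ i ^ u * W i)) + sum (λ i → ω i * (ω⁻¹ i ^ (x ℕ.+ u) * W′ i)))
        ≈⟨ distribˡ _ _ _ ⟩
      rootSum W u + rootSum W′ (x ℕ.+ u) ∎

  -- The residue of 1 / (1 - z^d) at a root ω is -ω/d. For pairwise coprime moduli, `term` is
  -- therefore minus the sum of the residues at the nontrivial roots of `modulus (b j)`, which is
  -- why `residueSum` subtracts `fourier`.
  term : ℕ → ∀ {n} → Vector Modulus (suc n) → Fin (suc n) → ℕ → Carrier
  term r b j u = rootSum (b j) (weight (b j) r (removeAt b j)) u

  fourier : ℕ → ∀ {n} → Vector Modulus n → ℕ → Carrier
  fourier r {zero}  b u = 0#
  fourier r {suc n} b u = sum λ j → term r b j u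

  fourier-suc : ∀ r {n} (b : Vector Modulus n) u → fourier (suc r) b (suc u) ≈ fourier (suc r) b u + fourier r b (suc u)
  fourier-suc r {zero}  b u = sym (+-identityˡ 0#)
  fourier-suc r {suc n} b u = trans
    (sum-cong {suc n} λ j → rootSum-step (b j) 1 (weight-suc (b j) r (removeAt b j)) u)
    (∑-distrib-+ (λ j → term (suc r) b j u) (λ j → term r b j (suc u)))

  term-removeAt : ∀ r {n} (b : Vector Modulus (suc (suc n))) → PairwiseCoprime (modulus ∘ b) → ∀ k u i →
    term r b (punchIn k i) (modulus (b k) ℕ.+ u) ≈
    term r b (punchIn k i) u + term r (removeAt b k) i (modulus (b k) ℕ.+ u)
  term-removeAt r b coprime k u i = rootSum-step m x step u
    where
    m = b (punchIn k i)
    x = modulus (b k)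

    step : ∀ l → weight m r (removeAt b (punchIn k i)) l ≈
                 1# * weight m r (removeAt (removeAt b k) i) l + ω m l ^ x * weight m r (removeAt b (punchIn k i)) l
    step l = begin
      q * product (removeAt f (punchIn k i))       ≈⟨ *-congˡ f≈ ⟩
      q * product (f k ∷ f′)                       ≈⟨ product-step (f k ∷ f′) Fin.zero
                                                        (κ-step m l x (root^#1 (root m l) (coprime (punchInᵢ≢i k i ∘ ≡.sym)))) q ⟩
      1# * (q * product f′) + ω m l ^ x * (q * product (f k ∷ f′))
                                                   ≈⟨ +-congˡ (*-congˡ (*-congˡ f≈)) ⟨
      1# * (q * product f′) + ω m l ^ x * (q * product (removeAt f (punchIn k i))) ∎
      where
      f  = κ m l ∘ modulus ∘ b
      f′ = removeAt (removeAt f k) i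
      q  = κ m l 1 ^ r
      f≈ = product-removeAt-punchIn f k i

  -- The term of index `k` is merely periodic, since ω^bₖ = 1 at its roots, and it has no
  -- counterpart once `b k` is dropped. In the other terms coprimality makes 1 - ω^bₖ invertible, so
  -- the factor can be split off.
  fourier-removeAt : ∀ r {n} (b : Vector Modulus (suc n)) → PairwiseCoprime (modulus ∘ b) → ∀ k u →
    fourier r b (modulus (b k) ℕ.+ u) ≈ fourier r b u + fourier r (removeAt b k) (modulus (b k) ℕ.+ u)
  fourier-removeAt r {n} b coprime k u = begin
    fourier r b (x ℕ.+ u)
      ≈⟨ sum-remove {i = k} (λ j → term r b j (x ℕ.+ u)) ⟩
    term r b k (x ℕ.+ u) + sum (λ i → term r b (punchIn k i) (x ℕ.+ u))
      ≈⟨ +-cong (rootSum-periodic (b k) (weight (b k) r (removeAt b k)) u) (others n b coprime k) ⟩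
    term r b k u + (sum (λ i → term r b (punchIn k i) u) + fourier r (removeAt b k) (x ℕ.+ u))
      ≈⟨ +-assoc _ _ _ ⟨
    term r b k u + sum (λ i → term r b (punchIn k i) u) + fourier r (removeAt b k) (x ℕ.+ u)
      ≈⟨ +-congʳ (sum-remove {i = k} (λ j → term r b j u)) ⟨
    fourier r b u + fourier r (removeAt b k) (x ℕ.+ u) ∎
    where
    x = modulus (b k)

    -- `fourier` is defined by cases on the length, which is known here only after a split on `n`.
    others : ∀ n (b : Vector Modulus (suc n)) → PairwiseCoprime (modulus ∘ b) → ∀ k →
      sum (λ i → term r b (punchIn k i) (modulus (b k) ℕ.+ u)) ≈
      sum (λ i → term r b (punchIn k i) u) + fourier r (removeAt b k) (modulus (b k) ℕ.+ u)
    others zero    b coprime k = sym (+-identityˡ 0#)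
    others (suc n) b coprime k = trans
      (sum-cong (term-removeAt r b coprime k u))
      (∑-distrib-+ (λ i → term r b (punchIn k i) u) (λ i → term r (removeAt b k) i (modulus (b k) ℕ.+ u)))

-- Expansions at 0 and at 1

module GeneratingFunctions {c ℓ₁ ℓ₂} (K : HeytingField c ℓ₁ ℓ₂) (char0 : CharacteristicZero K) where
  open HeytingFieldArithmetic K
  open FourierDedekind K char0 using (n·1#0)
  open ExpansionAt1 K
  open SeriesSemiring K
  open FieldProperties K
  open RootSums K char0 using (module Modulus; Modulus)
  open Modulus

  private
    module 𝕊 = CommutativeSemiring seriesSemiring
    module 𝕊-Identities = SemiringIdentities seriesSemiring

  -- It has two roles: in `J` and `count` it is the variable of the expansion at 0, in `T`, `I` and
  -- `res` it is the local parameter z - 1.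
  w : Series
  w zero          = 0#
  w (suc zero)    = 1#
  w (suc (suc _)) = 0#

  tl-w : tl w ≋ 1ˢ
  tl-w zero    = refl
  tl-w (suc _) = refl

  w*-zero : ∀ f → (w *ˢ f) 0 ≈ 0#
  w*-zero f = trans (+-identityʳ _) (zeroˡ _)

  w*-suc : ∀ f n → (w *ˢ f) (suc n) ≈ f n
  w*-suc f n = trans (+-cong (zeroˡ _) (trans (*ˢ-cong {g = f} tl-w 𝕊.refl n) (*ˢ-identityˡ f n))) (+-identityˡ _)

  w*-tl : ∀ f → f 0 ≈ 0# → f ≋ w *ˢ tl f
  w*-tl f f₀≈0 zero    = trans f₀≈0 (sym (w*-zero (tl f)))
  w*-tl f f₀≈0 (suc n) = sym (w*-suc (tl f) n)

  w^*-+ : ∀ x f n → (w ^ˢ x *ˢ f) (x ℕ.+ n) ≈ f n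
  w^*-+ zero    f n = *ˢ-identityˡ f n
  w^*-+ (suc x) f n = trans (*ˢ-assoc w (w ^ˢ x) f (suc (x ℕ.+ n)))
    (trans (w*-suc (w ^ˢ x *ˢ f) (x ℕ.+ n)) (w^*-+ x f n))

  w^*-< : ∀ x f {n} → n ℕ.< x → (w ^ˢ x *ˢ f) n ≈ 0#
  w^*-< (suc x) f {zero}  _         = trans (*ˢ-assoc w (w ^ˢ x) f 0) (w*-zero (w ^ˢ x *ˢ f))
  w^*-< (suc x) f {suc n} (s≤s n<x) = trans (*ˢ-assoc w (w ^ˢ x) f (suc n))
    (trans (w*-suc (w ^ˢ x *ˢ f) n) (w^*-< x f n<x))

  recip : (q : Series) → q 0 # 0# → Series
  recip q q₀#0 = Division.quotient 1ˢ q q₀#0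

  *-recip : ∀ q (q₀#0 : q 0 # 0#) → q *ˢ recip q q₀#0 ≋ 1ˢ
  *-recip q q₀#0 = Division.q*quotient≋p 1ˢ q q₀#0

  z*z⁻¹ : z *ˢ z⁻¹ ≋ 1ˢ
  z*z⁻¹ = *-recip z 1#0

  module _ (x : ℕ) (x≢0 : NonZero x) where
    1-w^x₀#0 : (1ˢ -ˢ w ^ˢ x) 0 # 0#
    1-w^x₀#0 = #-congʳ (sym (trans (+-congˡ (trans (-‿cong (lem x x≢0)) -0#≈0#)) (+-identityʳ 1#))) 1#0
      where
      lem : ∀ x → NonZero x → (w ^ˢ x) 0 ≈ 0#
      lem (suc x) _ = w*-zero (w ^ˢ x)

    -- 1 / (1 - w^x)
    J : Series
    J = recip (1ˢ -ˢ w ^ˢ x) 1-w^x₀#0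

    J-step : J ≋ 1ˢ +ˢ w ^ˢ x *ˢ J
    J-step = 𝕊-Identities.reciprocal-step {w ^ˢ x} {1ˢ} {1ˢ -ˢ w ^ˢ x} (*-recip _ 1-w^x₀#0) λ n → trans (sym (y-x+x≈y ((w ^ˢ x) n) (1ˢ n)))
      (trans (+-comm _ _) (+-congˡ {(w ^ˢ x) n} (sym (*ˢ-identityˡ (1ˢ -ˢ w ^ˢ x) n))))

    -- Together with `J-<`, this makes the coefficients of `J` the indicator of the multiples of
    -- `x`.
    J-+ : ∀ n → J (x ℕ.+ n) ≈ J n
    J-+ n = trans (J-step (x ℕ.+ n)) (trans (+-cong (1ˢ-x x≢0 n) (w^*-+ x J n)) (+-identityˡ _))
      where
      1ˢ-x : ∀ {x} → NonZero x → ∀ n → 1ˢ (x ℕ.+ n) ≈ 0#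
      1ˢ-x {suc x} _ n = refl

    J-< : ∀ {n} → n ℕ.< x → J n ≈ 1ˢ n
    J-< {n} n<x = trans (J-step n) (trans (+-congˡ (w^*-< x J n<x)) (+-identityʳ _))

    -- (1 - z^x) / w
    T : Series
    T = tl (1ˢ -ˢ z ^ˢ x)

    1-z^x-order : HasOrder (1ˢ -ˢ z ^ˢ x) 1
    1-z^x-order = 1-z^n-order x (n·1#0 x {{x≢0}})

    1-z^x≋w*T : 1ˢ -ˢ z ^ˢ x ≋ w *ˢ T
    1-z^x≋w*T = w*-tl _ (lower 1-z^x-order (s≤s z≤n))

    -- w / (1 - z^x)
    I : Series
    I = recip T (leading 1-z^x-order)

    T*I : T *ˢ I ≋ 1ˢ
    T*I = *-recip T (leading 1-z^x-order)

    I-step : I ≋ w +ˢ z ^ˢ x *ˢ I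
    I-step = 𝕊-Identities.reciprocal-step {z ^ˢ x} {w} T*I λ n → trans (sym (y-x+x≈y ((z ^ˢ x) n) (1ˢ n)))
      (trans (+-comm _ _) (+-congˡ {(z ^ˢ x) n} (1-z^x≋w*T n)))

    -- The leading coefficient of 1 - z^x in powers of z - 1 is -x, so 1 / (1 - z^x) has residue
    -- -1/x at 1.
    I₀ : (x · 1#) * I 0 ≈ - 1#
    I₀ = begin
      (x · 1#) * I 0          ≈⟨ -‿involutive _ ⟨
      - - ((x · 1#) * I 0)    ≈⟨ -‿cong (-‿distribˡ-* _ _) ⟩
      - (- (x · 1#) * I 0)    ≈⟨ -‿cong (*-congʳ (trans (+-identityˡ _) (-‿cong (z^n₁ x)))) ⟨
      - (T 0 * I 0)           ≈⟨ -‿cong (+-identityʳ _) ⟨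
      - (T *ˢ I) 0            ≈⟨ -‿cong (T*I 0) ⟩
      - 1#                    ∎
      where open ≈-Reasoning setoid

  -- The extra `w` aligns the indices: the residue of z^(-u) G at 0 is the coefficient of z^(u-1) in
  -- G, that is, of z^u in z G.
  shift-step : ∀ x {A B} → A ≋ 1ˢ *ˢ B +ˢ w ^ˢ x *ˢ A → ∀ u →
               (w *ˢ A) (x ℕ.+ u) ≈ (w *ˢ A) u + (w *ˢ B) (x ℕ.+ u)
  shift-step x {A} {B} A≋ u = trans (𝕊-Identities.scale-step {A} {B} {1ˢ} {w ^ˢ x} A≋ w (x ℕ.+ u))
    (trans (+-comm _ _) (+-cong (w^*-+ x (w *ˢ A) u) (𝕊.*-congʳ {B} (𝕊.*-identityʳ w) (x ℕ.+ u))))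

  -- 1 / ((1 - w)^r ∏ₖ (1 - w^bₖ))
  countSeries : ℕ → ∀ {n} → Vector Modulus n → Series
  countSeries r b = J 1 _ ^ˢ r *ˢ productˢ (λ k → J (modulus (b k)) (nonZero (b k)))

  countSeries-[] : ∀ (b : Vector Modulus 0) t → countSeries 1 b t ≈ 1#
  countSeries-[] b t = trans (*ˢ-identityʳ (J 1 _ ^ˢ 1) t) (trans (*ˢ-identityʳ (J 1 _) t) (J≈1 t))
    where
    J≈1 : ∀ t → J 1 _ t ≈ 1#
    J≈1 zero    = J-< 1 _ (s≤s z≤n)
    J≈1 (suc t) = trans (J-+ 1 _ t) (J≈1 t)

  -- The coefficient of w^u in w / ((1 - w)^r ∏ₖ (1 - w^bₖ))
  count : ℕ → ∀ {n} → Vector Modulus n → ℕ → Carrier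
  count r b = w *ˢ countSeries r b

  count-suc : ∀ r {n} (b : Vector Modulus n) u → count (suc r) b (suc u) ≈ count (suc r) b u + count r b (suc u)
  count-suc r b = shift-step 1 {countSeries (suc r) b} (𝕊-Identities.power-step {J 1 _} {1ˢ} {w ^ˢ 1} (J-step 1 _) r
    (productˢ (λ k → J (modulus (b k)) (nonZero (b k)))))

  count-removeAt : ∀ r {n} (b : Vector Modulus (suc n)) k u →
    count r b (modulus (b k) ℕ.+ u) ≈ count r b u + count r (removeAt b k) (modulus (b k) ℕ.+ u)
  count-removeAt r b k = shift-step (modulus (b k)) {countSeries r b}
    (𝕊-Identities.product-step (λ k → J (modulus (b k)) (nonZero (b k))) k {1ˢ} {w ^ˢ modulus (b k)} (J-step (modulus (b k)) (nonZero (b k))) (J 1 _ ^ˢ r))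

  residue-cong : ∀ v {f g} → f ≋ g → residue (laurent v f) ≈ residue (laurent v g)
  residue-cong zero    f≋g = refl
  residue-cong (suc v) f≋g = f≋g v

  residue-w* : ∀ v f → residue (laurent (suc v) (w *ˢ f)) ≈ residue (laurent v f)
  residue-w* zero    f = w*-zero f
  residue-w* (suc v) f = w*-suc f v

  -- The `w` in front of `B` cancels one order of the pole, which is the order lost with the removed
  -- factor.
  residue-step : ∀ v x {A B} → A ≋ w *ˢ B +ˢ z ^ˢ x *ˢ A → ∀ u →
    residue (laurent (suc v) (z⁻¹ ^ˢ (x ℕ.+ u) *ˢ A)) ≈
    residue (laurent (suc v) (z⁻¹ ^ˢ u *ˢ A)) + residue (laurent v (z⁻¹ ^ˢ (x ℕ.+ u) *ˢ B))
  residue-step v x {A} {B} A≋ u = trans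
    (residue-cong (suc v) (𝕊-Identities.power-scale-step z*z⁻¹ {A} {B} {w} x A≋ u))
    (+-congˡ {(z⁻¹ ^ˢ u *ˢ A) v} (residue-w* v (z⁻¹ ^ˢ (x ℕ.+ u) *ˢ B)))

  -- w^(r+n) / ((1 - z)^r ∏ₖ (1 - z^bₖ))
  regularPart : ℕ → ∀ {n} → Vector Modulus n → Series
  regularPart r b = I 1 _ ^ˢ r *ˢ productˢ (λ k → I (modulus (b k)) (nonZero (b k)))

  -- Res (z^(-u) / ((1 - z)^r ∏ₖ (1 - z^bₖ)), z = 1)
  res : ℕ → ∀ {n} → Vector Modulus n → ℕ → Carrier
  res r {n} b u = residue (laurent (r ℕ.+ n) (z⁻¹ ^ˢ u *ˢ regularPart r b))

  res-suc : ∀ r {n} (b : Vector Modulus n) u → res (suc r) b (suc u) ≈ res (suc r) b u + res r b (suc u)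
  res-suc r {n} b = residue-step (r ℕ.+ n) 1 {regularPart (suc r) b} (𝕊-Identities.power-step {I 1 _} {w} {z ^ˢ 1} (I-step 1 _) r
    (productˢ (λ k → I (modulus (b k)) (nonZero (b k)))))

  res-removeAt : ∀ r {n} (b : Vector Modulus (suc n)) k u →
    res r b (modulus (b k) ℕ.+ u) ≈ res r b u + res r (removeAt b k) (modulus (b k) ℕ.+ u)
  res-removeAt r {n} b k u = trans (pole (x ℕ.+ u)) (trans step (+-congʳ (sym (pole u))))
    where
    x = modulus (b k)
    A = regularPart r b

    -- `residue` matches on the pole order, and `r ℕ.+ suc n` does not compute to a successor.
    pole : ∀ u → res r b u ≈ residue (laurent (suc (r ℕ.+ n)) (z⁻¹ ^ˢ u *ˢ A))
    pole u = reflexive (≡.cong (λ v → residue (laurent v (z⁻¹ ^ˢ u *ˢ A))) (ℕₚ.+-suc r n))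

    step : residue (laurent (suc (r ℕ.+ n)) (z⁻¹ ^ˢ (x ℕ.+ u) *ˢ A)) ≈
           residue (laurent (suc (r ℕ.+ n)) (z⁻¹ ^ˢ u *ˢ A)) + res r (removeAt b k) (x ℕ.+ u)
    step = residue-step (r ℕ.+ n) x {A} {regularPart r (removeAt b k)}
      (𝕊-Identities.product-step (λ k → I (modulus (b k)) (nonZero (b k))) k {w} {z ^ˢ x} (I-step x (nonZero (b k))) (I 1 _ ^ˢ r)) u

-- Vanishing of the residue sum

module ResidueTheorem {c ℓ₁ ℓ₂} (K : HeytingField c ℓ₁ ℓ₂) (char0 : CharacteristicZero K) where
  open HeytingFieldArithmetic K
  open FourierDedekind K char0 using (n·1#0)
  open ExpansionAt1 K
  open SeriesSemiring K
  open FieldProperties K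
  open RootSums K char0
  open GeneratingFunctions K char0
  open Modulus
  open Periodicity setoid
  open SemiringMult semiring using (×-assoc-*; ×-congʳ; ×-homo-1)
  open CommutativeSemigroupProperties (CommutativeMonoid.commutativeSemigroup (CommutativeRing.+-commutativeMonoid commutativeRing))
    using () renaming (interchange to +-interchange)
  open SemiringSolver commutativeSemiring using (solve; _:=_; _:*_; con)
  open ≈-Reasoning setoid

  -- Both sides have period `modulus m`, so they need comparing only for `u` below it. There `J` is
  -- 1 at 0 and 0 elsewhere, and the power sums are the same times the modulus.
  orthogonality : ∀ m u → (modulus m · 1#) * J (modulus m) (nonZero m) u ≈ 1# + sum (λ i → ω⁻¹ m i ^ u)
  orthogonality record { modulus = suc d ; roots = roots } u =
    trans (periodic-≈ {suc d} {λ u → (suc d · 1#) * J (suc d) _ u} {powerSum} (λ u → *-congˡ (J-+ (suc d) _ u)) powerSum-+ small u)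
      (+-congʳ (1^n≈1 u))
    where
    open Orthogonality d roots
    small : ∀ {u} → u ℕ.< suc d → (suc d · 1#) * J (suc d) _ u ≈ powerSum u
    small {zero}  0<d       = trans (*-congˡ (J-< (suc d) _ 0<d)) (trans (*-identityʳ _) (sym powerSum-0))
    small {suc u} (s≤s u<d) = begin
      (suc d · 1#) * J (suc d) _ (suc u)    ≈⟨ *-congˡ (J-< (suc d) _ (s≤s u<d)) ⟩
      (suc d · 1#) * 0#                     ≈⟨ zeroʳ _ ⟩
      0#                                    ≈⟨ powerSum≈0 (fromℕ< u<d) ⟨
      powerSum (suc (toℕ (fromℕ< u<d)))     ≡⟨ ≡.cong (powerSum ∘ suc) (toℕ-fromℕ< u<d) ⟩
      powerSum (suc u)                      ∎

  -- The sum over all the poles of the residues of z^(-u) / ((1 - z)^r ∏ₖ (1 - z^bₖ))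
  residueSum : ℕ → ∀ {n} → Vector Modulus n → ℕ → Carrier
  residueSum r b u = (count r b u + res r b u) - fourier r b u

  private
    combine : ∀ {a a₁ a₂ b b₁ b₂ c c₁ c₂} → a ≈ a₁ + a₂ → b ≈ b₁ + b₂ → c ≈ c₁ + c₂ →
              (a + b) - c ≈ ((a₁ + b₁) - c₁) + ((a₂ + b₂) - c₂)
    combine a≈ b≈ c≈ = trans (+-cong (trans (+-cong a≈ b≈) (+-interchange _ _ _ _)) (-‿cong c≈)) ([a+b]-[c+d] _ _ _ _)

  residueSum≈0 : ∀ r {n} (b : Vector Modulus n) u → residueSum r b u ≈ 0# → count r b u ≈ - res r b u + fourier r b u
  residueSum≈0 r b u s≈0 = begin
    C                       ≈⟨ +-identityˡ C ⟨
    0# + C                  ≈⟨ +-congʳ (-‿inverseˡ ρ) ⟨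
    - ρ + ρ + C             ≈⟨ +-assoc _ _ _ ⟩
    - ρ + (ρ + C)           ≈⟨ +-congˡ (+-comm ρ C) ⟩
    - ρ + (C + ρ)           ≈⟨ +-congˡ (x-y≈0⇒x≈y s≈0) ⟩
    - ρ + fourier r b u     ∎
    where
    C = count r b u
    ρ = res r b u

  residueSum-suc : ∀ r {n} (b : Vector Modulus n) u →
    residueSum (suc r) b (suc u) ≈ residueSum (suc r) b u + residueSum r b (suc u)
  residueSum-suc r b u = combine (count-suc r b u) (res-suc r b u) (fourier-suc r b u)

  residueSum-removeAt : ∀ r {n} (b : Vector Modulus (suc n)) → PairwiseCoprime (modulus ∘ b) → ∀ k u →
    residueSum r b (modulus (b k) ℕ.+ u) ≈ residueSum r b u + residueSum r (removeAt b k) (modulus (b k) ℕ.+ u)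
  residueSum-removeAt r b coprime k u =
    combine (count-removeAt r b k u) (res-removeAt r b k u) (fourier-removeAt r b coprime k u)

  -- Exponent 0 is left out: 1 / (1 - z) has residue -1 at its only finite pole.
  Vanishes : ℕ → ∀ {n} → Vector Modulus n → Set ℓ₁
  Vanishes r b = ∀ u → residueSum r b (suc u) ≈ 0#

  vanishes-nonZero : ∀ r {n} (b : Vector Modulus n) → Vanishes r b → ∀ {x} → NonZero x → ∀ u → residueSum r b (x ℕ.+ u) ≈ 0#
  vanishes-nonZero r b van {suc x} _ u = van (x ℕ.+ u)

  -- The correction has the argument `modulus (b k) ℕ.+ u`, which is positive even for `u` = 0, so
  -- vanishing at positive exponents gives periodicity from 0 on.
  removeAt-periodic : ∀ r {n} (b : Vector Modulus (suc n)) → PairwiseCoprime (modulus ∘ b) →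
    ∀ k → Vanishes r (removeAt b k) → Periodic (modulus (b k)) (residueSum r b)
  removeAt-periodic r b coprime k van u = trans (residueSum-removeAt r b coprime k u)
    (trans (+-congˡ (vanishes-nonZero r (removeAt b k) van (nonZero (b k)) u)) (+-identityʳ _))

  suc-periodic : ∀ r {n} (b : Vector Modulus n) → Vanishes r b → Periodic 1 (residueSum (suc r) b)
  suc-periodic r b van u = trans (residueSum-suc r b u) (trans (+-congˡ (van u)) (+-identityʳ _))

  constant : ∀ {f} → Periodic 1 f → ∀ u → f u ≈ f 0
  constant {f} per zero    = refl
  constant {f} per (suc u) = trans (per u) (constant {f} per u)

  -- A constant residue sum s is 0: the residue sum with a further factor 1 - z
  -- increases by b₀ s over an interval of length b₀, but it has period b₀.
  constant-vanishes : ∀ r {n} (b : Vector Modulus (suc n)) → PairwiseCoprime (modulus ∘ b) →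
    Periodic 1 (residueSum r b) → Vanishes (suc r) (removeAt b Fin.zero) → Vanishes r b
  constant-vanishes r b coprime per van u = trans (constant {residueSum r b} per (suc u))
    (#0-cancelˡ (n·1#0 x {{nonZero (b Fin.zero)}}) (begin
      (x · 1#) * s                             ≈⟨ ×-assoc-* x 1# s ⟩
      x · (1# * s)                             ≈⟨ ×-congʳ x (*-identityˡ s) ⟩
      x · s                                    ≈⟨ +-cancelʳ (residueSum (suc r) b 0) (begin
        x · s + residueSum (suc r) b 0         ≈⟨ +-comm _ _ ⟩
        residueSum (suc r) b 0 + x · s         ≈⟨ increase x ⟨
        residueSum (suc r) b x                 ≡⟨ ≡.cong (residueSum (suc r) b) (ℕₚ.+-identityʳ x) ⟨
        residueSum (suc r) b (x ℕ.+ 0)         ≈⟨ removeAt-periodic (suc r) b coprime Fin.zero van 0 ⟩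
        residueSum (suc r) b 0                 ≈⟨ +-identityˡ _ ⟨
        0# + residueSum (suc r) b 0            ∎) ⟩
      0#                                       ∎))
    where
    x = modulus (b Fin.zero)
    s = residueSum r b 0

    increase : ∀ u → residueSum (suc r) b u ≈ residueSum (suc r) b 0 + u · s
    increase zero    = sym (+-identityʳ _)
    increase (suc u) = begin
      residueSum (suc r) b (suc u)                       ≈⟨ residueSum-suc r b u ⟩
      residueSum (suc r) b u + residueSum r b (suc u)    ≈⟨ +-cong (increase u) (constant {residueSum r b} per (suc u)) ⟩
      residueSum (suc r) b 0 + u · s + s                 ≈⟨ +-assoc _ _ _ ⟩
      residueSum (suc r) b 0 + (u · s + s)               ≈⟨ +-congˡ (+-comm _ _) ⟩
      residueSum (suc r) b 0 + (s + u · s)               ∎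

  z⁻¹₀ : z⁻¹ 0 ≈ 1#
  z⁻¹₀ = trans (sym (trans (+-identityʳ _) (*-identityˡ _))) (z*z⁻¹ 0)

  z⁻¹^₀ : ∀ u → (z⁻¹ ^ˢ u) 0 ≈ 1#
  z⁻¹^₀ zero    = refl
  z⁻¹^₀ (suc u) = trans (+-identityʳ _) (trans (*-cong z⁻¹₀ (z⁻¹^₀ u)) (*-identityˡ 1#))

  res-simple : ∀ {f g} u → g ≋ f → residue (laurent 1 (z⁻¹ ^ˢ u *ˢ g)) ≈ f 0
  res-simple u g≋f = trans (+-identityʳ _) (trans (*-cong (z⁻¹^₀ u) (g≋f 0)) (*-identityˡ _))

  -- As 1 - z = -(z - 1), the series `I 1 _` is the constant -1.
  I₁-suc : ∀ n → I 1 _ (suc n) ≈ 0#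
  I₁-suc n = #0-cancelˡ (leading (1-z^x-order 1 _)) (begin
    T 1 _ 0 * I 1 _ (suc n)                          ≈⟨ +-identityʳ _ ⟨
    T 1 _ 0 * I 1 _ (suc n) + 0#                     ≈⟨ +-congˡ (trans (*ˢ-cong {g = I 1 _} tl-T≈0 (λ n → refl) n) (*ˢ-zeroˡ (I 1 _) n)) ⟨
    (T 1 _ *ˢ I 1 _) (suc n)                         ≈⟨ T*I 1 _ (suc n) ⟩
    0#                                               ∎)
    where
    tl-T≈0 : tl (T 1 _) ≋ 0ˢ
    tl-T≈0 n = x≈y⇒x-y≈0 (sym (*ˢ-identityʳ z (suc (suc n))))

  module _ (b : Vector Modulus 0) where

    vanishes-1 : Vanishes 1 b
    vanishes-1 u = begin
      (count 1 b (suc u) + res 1 b (suc u)) - 0#    ≈⟨ +-cong (+-cong count≈1 res≈-1) -0#≈0# ⟩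
      (1# - 1#) + 0#                                ≈⟨ +-identityʳ _ ⟩
      1# - 1#                                       ≈⟨ -‿inverseʳ 1# ⟩
      0#                                            ∎
      where
      count≈1 : count 1 b (suc u) ≈ 1#
      count≈1 = trans (w*-suc (countSeries 1 b) u) (countSeries-[] b u)

      res≈-1 : res 1 b (suc u) ≈ - 1#
      res≈-1 = begin
        res 1 b (suc u)        ≈⟨ res-simple (suc u) (≋-trans (*ˢ-identityʳ (I 1 _ ^ˢ 1)) (*ˢ-identityʳ (I 1 _))) ⟩
        I 1 _ 0                ≈⟨ *-identityˡ _ ⟨
        1# * I 1 _ 0           ≈⟨ *-congʳ (×-homo-1 1#) ⟨
        (1 · 1#) * I 1 _ 0     ≈⟨ I₀ 1 _ ⟩
        - 1#                   ∎

    -- At exponent 0 there is no pole at 0, and 1 / (1 - z)^(r+2) is a pure pole of order at least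
    -- 2. With a single factor the value would be -1, so that case starts the induction separately.
    residueSum-0 : ∀ r → residueSum (suc (suc r)) b 0 ≈ 0#
    residueSum-0 r = begin
      (count (suc (suc r)) b 0 + res (suc (suc r)) b 0) - 0#
        ≈⟨ +-cong (+-cong (w*-zero (countSeries (suc (suc r)) b)) (trans (≋-trans (*ˢ-identityˡ (regularPart (suc (suc r)) b)) (*ˢ-identityʳ (I 1 _ ^ˢ suc (suc r))) (suc (r ℕ.+ 0))) (I₁^-suc (suc (suc r)) (r ℕ.+ 0)))) -0#≈0# ⟩
      (0# + 0#) + 0#
        ≈⟨ trans (+-identityʳ _) (+-identityʳ _) ⟩
      0# ∎
      where
      I₁^-suc : ∀ r n → (I 1 _ ^ˢ r) (suc n) ≈ 0#
      I₁^-suc zero    n = refl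
      I₁^-suc (suc r) n = begin
        I 1 _ 0 * (I 1 _ ^ˢ r) (suc n) + (tl (I 1 _) *ˢ I 1 _ ^ˢ r) n
          ≈⟨ +-cong (trans (*-congˡ (I₁^-suc r n)) (zeroʳ _))
               (trans (*ˢ-cong {g = I 1 _ ^ˢ r} I₁-suc (λ n → refl) n) (*ˢ-zeroˡ (I 1 _ ^ˢ r) n)) ⟩
        0# + 0# ≈⟨ +-identityʳ 0# ⟩
        0#      ∎

    vanishes-suc : ∀ r → Vanishes (suc r) b
    vanishes-suc zero    u = vanishes-1 u
    vanishes-suc (suc r) u =
      trans (constant {residueSum (suc (suc r)) b} (suc-periodic (suc r) b (vanishes-suc r)) (suc u)) (residueSum-0 r)

  -- Multiplied by the modulus, the residues at 0 and at 1 become 1 + `s` and -1, and the Fourier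
  -- part becomes `s`.
  vanishes-single : ∀ (b : Vector Modulus 1) → Vanishes 0 b
  vanishes-single b u = #0-cancelˡ (n·1#0 (modulus m) {{nonZero m}}) (begin
    x * ((count 0 b (suc u) + res 0 b (suc u)) - fourier 0 b (suc u))
      ≈⟨ *-congˡ (+-cong (+-cong count≈ res≈) (-‿cong fourier≈)) ⟩
    x * ((Jᵤ + I m′ m≢0 0) - modulus⁻¹ m * s)
      ≈⟨ trans (distribˡ _ _ _) (+-cong (distribˡ _ _ _) (sym (-‿distribʳ-* _ _))) ⟩
    (x * Jᵤ + x * I m′ m≢0 0) - x * (modulus⁻¹ m * s)
      ≈⟨ +-cong (+-cong (orthogonality m u) (I₀ m′ m≢0)) (-‿cong (trans (sym (*-assoc _ _ _)) (trans (*-congʳ (inverseʳ (n·1#0 m′ {{m≢0}}))) (*-identityˡ s)))) ⟩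
    ((1# + s) - 1#) - s
      ≈⟨ +-congʳ (trans (+-congʳ (+-comm 1# s)) (trans (+-assoc s 1# (- 1#)) (trans (+-congˡ (-‿inverseʳ 1#)) (+-identityʳ s)))) ⟩
    s - s
      ≈⟨ -‿inverseʳ s ⟩
    0# ∎)
    where
    m   = b Fin.zero
    m′  = modulus m
    m≢0 = nonZero m
    x   = m′ · 1#
    Jᵤ  = J m′ m≢0 u
    s   = sum (λ i → ω⁻¹ m i ^ u)

    count≈ : count 0 b (suc u) ≈ Jᵤ
    count≈ = trans (w*-suc (countSeries 0 b) u)
      (≋-trans (*ˢ-identityˡ (J m′ m≢0 *ˢ 1ˢ)) (*ˢ-identityʳ (J m′ m≢0)) u)

    res≈ : res 0 b (suc u) ≈ I m′ m≢0 0
    res≈ = res-simple (suc u) (≋-trans (*ˢ-identityˡ (I m′ m≢0 *ˢ 1ˢ)) (*ˢ-identityʳ (I m′ m≢0)))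

    fourier≈ : fourier 0 b (suc u) ≈ modulus⁻¹ m * s
    fourier≈ = trans (+-identityʳ _) (*-congˡ (sum-cong λ i → begin
      ω m i * (ω⁻¹ m i * ω⁻¹ m i ^ u * (1# * 1#))    ≈⟨ solve 3 (λ a b c → a :* (b :* c :* (con 1 :* con 1)) := a :* b :* c) refl (ω m i) (ω⁻¹ m i) (ω⁻¹ m i ^ u) ⟩
      ω m i * ω⁻¹ m i * ω⁻¹ m i ^ u                  ≈⟨ *-congʳ (ω*ω⁻¹ m i) ⟩
      1# * ω⁻¹ m i ^ u                               ≈⟨ *-identityˡ _ ⟩
      ω⁻¹ m i ^ u                                    ∎))

  removeAt-coprime : ∀ {n} (b : Vector Modulus (suc n)) → PairwiseCoprime (modulus ∘ b) →
    ∀ k → PairwiseCoprime (modulus ∘ removeAt b k)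
  removeAt-coprime b coprime k i≢j = coprime (i≢j ∘ punchIn-injective k _ _)

  coprime-vanishes : ∀ {n} (b : Vector Modulus (suc (suc n))) → PairwiseCoprime (modulus ∘ b) →
    (∀ r k → Vanishes r (removeAt b k)) → Vanishes 0 b
  coprime-vanishes b coprime rest = constant-vanishes 0 b coprime
    (coprime-periodic {f = residueSum 0 b} (coprime {Fin.zero} {Fin.suc Fin.zero} λ ())
      (removeAt-periodic 0 b coprime Fin.zero (rest 0 Fin.zero))
      (removeAt-periodic 0 b coprime (Fin.suc Fin.zero) (rest 0 (Fin.suc Fin.zero))))
    (rest 1 Fin.zero)

  r+1+n≢0 : ∀ r n → NonZero (r ℕ.+ suc n)
  r+1+n≢0 r n = ℕ.>-nonZero (ℕₚ.<-≤-trans (s≤s z≤n) (ℕₚ.m≤n+m (suc n) r))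

  -- Induction on `n`, then on `r`: `r` may grow when `n` drops, as `constant-vanishes` demands. The
  -- case `r` = `n` = 0 is false, since z^(-1) has residue 1 at 0.
  vanishes : ∀ n r (b : Vector Modulus n) → PairwiseCoprime (modulus ∘ b) → NonZero (r ℕ.+ n) → Vanishes r b
  vanishes zero          (suc r) b _       _ = vanishes-suc b r
  vanishes (suc zero)    zero    b _       _ = vanishes-single b
  vanishes (suc (suc n)) zero    b coprime _ = coprime-vanishes b coprime λ r k →
    vanishes (suc n) r (removeAt b k) (removeAt-coprime b coprime k) (r+1+n≢0 r n)
  vanishes (suc n)       (suc r) b coprime _ = constant-vanishes (suc r) b coprime
    (suc-periodic r b (vanishes (suc n) r b coprime (r+1+n≢0 r n)))
    (vanishes n (suc (suc r)) (removeAt b Fin.zero) (removeAt-coprime b coprime Fin.zero) _)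

-- Identification with R and the Fourier-Dedekind sums

module Comparison {c ℓ₁ ℓ₂} (K : HeytingField c ℓ₁ ℓ₂) (char0 : CharacteristicZero K) where
  open HeytingFieldArithmetic K
  open RootsOfUnity K
  open FourierDedekind K char0 using (σ)
  open Residue K char0
  open ExpansionAt1 K
  open SeriesSemiring K
  open FieldProperties K
  open RootSums K char0
  open GeneratingFunctions K char0
  open ResidueTheorem K char0
  open Modulus
  open AbelianGroupProperties +-abelianGroup using () renaming (⁻¹-∙-comm to -x-y≈-[x+y])
  open SemiringSum semiring using (*-distribˡ-sum)
  open SemiringSolver commutativeSemiring using (solve; _:=_; _:*_; con)
  open SemiringIdentities commutativeSemiring using (product-scale; product-inverse; product-++)
  private
    module 𝕊 = CommutativeSemiring seriesSemiring
    module 𝕊-Identities = SemiringIdentities seriesSemiring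

  -- Each factor ω^c - 1 is -1 times 1 - ω^c, whence the sign; the factor ω in `rootSum` turns the
  -- exponent -(t+1) into -t. `W` enters only as an inverse of the product, and inverses are unique.
  rootSum≈σ : ∀ d (d≢0 : NonZero d) (roots : NontrivialRootsOfUnity d) t → NonZero t → ∀ {n} (cs : Vector ℤ n) cs⊥d →
    let m = record { modulus = d ; nonZero = d≢0 ; roots = roots } in ∀ W →
    (∀ i → product (λ k → 1# - value (root m i) ^ᶻ cs k ⟨ root#0 {{d≢0}} (root m i) ⟩) * W i ≈ 1#) →
    (- 1#) ^ n * σ d {{d≢0}} roots (ℤ.- (+ t)) cs cs⊥d ≈ rootSum m W (suc t)
  rootSum≈σ d d≢0 roots (suc t) _ {n} cs cs⊥d W inverse = begin
    s * (sum summand * modulus⁻¹ m)         ≈⟨ solve 3 (λ s a d → s :* (a :* d) := d :* (s :* a)) refl s (sum summand) (modulus⁻¹ m) ⟩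
    modulus⁻¹ m * (s * sum summand)         ≈⟨ *-congˡ (*-distribˡ-sum s summand) ⟩
    modulus⁻¹ m * sum (λ i → s * summand i) ≈⟨ *-congˡ (sum-cong λ i → term≈ i (A#0 i)) ⟩
    rootSum m W (suc (suc t))               ∎
    where
    open ≈-Reasoning setoid
    m = record { modulus = d ; nonZero = d≢0 ; roots = roots }
    s = (- 1#) ^ n

    h : Fin (d ℕ.∸ 1) → ℤ → Carrier
    h i c = value (root m i) ^ᶻ c ⟨ root#0 {{d≢0}} (root m i) ⟩

    A#0 : ∀ i → product (λ k → h i (cs k) - 1#) # 0#
    A#0 i = product-#0 _ λ k → #⇒-#0 (root^ᶻ#1 {{d≢0}} (root m i) (cs k) (cs⊥d k))

    summand : Vector Carrier (d ℕ.∸ 1)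
    summand i = ω⁻¹ m i ^ suc t * inv _ (A#0 i)

    x-1≈-1*[1-x] : ∀ x → x - 1# ≈ - 1# * (1# - x)
    x-1≈-1*[1-x] x = begin
      x - 1#                ≈⟨ +-congʳ (-‿involutive x) ⟨
      - - x - 1#            ≈⟨ +-comm _ _ ⟩
      - 1# - - x            ≈⟨ -x-y≈-[x+y] 1# (- x) ⟩
      - (1# - x)            ≈⟨ -1*x≈-x _ ⟨
      - 1# * (1# - x)       ∎

    weight≈ : ∀ i (A#0 : product (λ k → h i (cs k) - 1#) # 0#) → s * inv _ A#0 ≈ W i
    weight≈ i A#0 = inverse-unique {product (λ k → 1# - h i (cs k))} (begin
      A′ * (s * A⁻¹)   ≈⟨ solve 3 (λ a s b → a :* (s :* b) := s :* a :* b) refl A′ s A⁻¹ ⟩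
      s * A′ * A⁻¹     ≈⟨ *-congʳ (product-scale (- 1#) (λ k → x-1≈-1*[1-x] (h i (cs k)))) ⟨
      product (λ k → h i (cs k) - 1#) * A⁻¹            ≈⟨ inverseʳ A#0 ⟩
      1#               ∎) (inverse i)
      where
      A′ = product (λ k → 1# - h i (cs k))
      A⁻¹ = inv _ A#0

    term≈ : ∀ i (A#0 : product (λ k → h i (cs k) - 1#) # 0#) →
            s * (ω⁻¹ m i ^ suc t * inv _ A#0) ≈ ω m i * (ω⁻¹ m i ^ suc (suc t) * W i)
    term≈ i A#0 = begin
      s * (ω⁻¹ m i ^ suc t * inv _ A#0)               ≈⟨ solve 3 (λ s y a → s :* (y :* a) := y :* (s :* a)) refl s (ω⁻¹ m i ^ suc t) (inv _ A#0) ⟩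
      ω⁻¹ m i ^ suc t * (s * inv _ A#0)               ≈⟨ *-congˡ (weight≈ i A#0) ⟩
      ω⁻¹ m i ^ suc t * W i                           ≈⟨ *-identityˡ _ ⟨
      1# * (ω⁻¹ m i ^ suc t * W i)                    ≈⟨ *-congʳ (ω*ω⁻¹ m i) ⟨
      ω m i * ω⁻¹ m i * (ω⁻¹ m i ^ suc t * W i)       ≈⟨ solve 4 (λ a b c w → a :* b :* (c :* w) := a :* (b :* c :* w)) refl (ω m i) (ω⁻¹ m i) (ω⁻¹ m i ^ suc t) (W i) ⟩
      ω m i * (ω⁻¹ m i ^ suc (suc t) * W i)           ∎

  module _ {n} (a : Vector ℕ n) (a≢0 : ∀ k → NonZero (a k)) (roots : ∀ j → NontrivialRootsOfUnity (a j)) where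

    moduli : Vector Modulus n
    moduli j = record { modulus = a j ; nonZero = a≢0 j ; roots = roots j }

    -- (1 - z)(1 - z^a₁)⋯(1 - z^aₙ) / w^(n+1)
    unitPart : Series
    unitPart = T 1 _ *ˢ productˢ (λ k → T (a k) (a≢0 k))

    denominator≋ : denominator a ≋ w ^ˢ suc n *ˢ unitPart
    denominator≋ = 𝕊.trans
      (𝕊.*-cong {1ˢ -ˢ z} {w *ˢ T 1 _}
        (𝕊.trans (λ k → +-congˡ (-‿cong (sym (*ˢ-identityʳ z k)))) (1-z^x≋w*T 1 _))
        (𝕊-Identities.product-scale w {λ k → 1ˢ -ˢ z ^ˢ a k} (λ k → 1-z^x≋w*T (a k) (a≢0 k))))
      (𝕊-Identities.interchange w (T 1 _) (w ^ˢ n) (productˢ (λ k → T (a k) (a≢0 k))))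

    denominator-shift : (λ k → denominator a (k ℕ.+ suc n)) ≋ unitPart
    denominator-shift k = trans (reflexive (≡.cong (denominator a) (ℕₚ.+-comm k (suc n))))
      (trans (denominator≋ (suc n ℕ.+ k)) (w^*-+ (suc n) unitPart k))

    unitPart*regularPart : unitPart *ˢ regularPart 1 moduli ≋ 1ˢ
    unitPart*regularPart = 𝕊.trans
      (𝕊-Identities.interchange (T 1 _) (productˢ (λ k → T (a k) (a≢0 k))) (I 1 _ ^ˢ 1) (productˢ (λ k → I (a k) (a≢0 k))))
      (𝕊.trans (𝕊.*-cong {T 1 _ *ˢ I 1 _ ^ˢ 1} {1ˢ}
          (𝕊.trans (𝕊.*-congˡ {T 1 _} (*ˢ-identityʳ (I 1 _))) (T*I 1 _))
          (𝕊-Identities.product-inverse {f = λ k → T (a k) (a≢0 k)} (λ k → T*I (a k) (a≢0 k))))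
        (*ˢ-identityˡ 1ˢ))

    -- `q` is kept abstract because the shifted denominator equals `unitPart` only pointwise. As
    -- `unitPart` is invertible, the defining equation of the division determines the quotient.
    quotient≋ : ∀ p q (q₀#0 : q 0 # 0#) → q ≋ unitPart → Division.quotient p q q₀#0 ≋ p *ˢ regularPart 1 moduli
    quotient≋ p q q₀#0 q≋ = begin
      Q                           ≈⟨ *ˢ-identityˡ Q ⟨
      1ˢ *ˢ Q                     ≈⟨ 𝕊.*-congʳ {Q} unitPart*regularPart ⟨
      unitPart *ˢ V *ˢ Q          ≈⟨ 𝕊.*-congʳ {Q} (*ˢ-comm unitPart V) ⟩
      V *ˢ unitPart *ˢ Q          ≈⟨ *ˢ-assoc V unitPart Q ⟩
      V *ˢ (unitPart *ˢ Q)        ≈⟨ 𝕊.*-congˡ {V} (𝕊.*-congʳ {Q} q≋) ⟨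
      V *ˢ (q *ˢ Q)               ≈⟨ 𝕊.*-congˡ {V} (Division.q*quotient≋p p q q₀#0) ⟩
      V *ˢ p                      ≈⟨ *ˢ-comm V p ⟩
      p *ˢ V                      ∎
      where
      open ≈-Reasoning 𝕊.setoid
      Q = Division.quotient p q q₀#0
      V = regularPart 1 moduli

    R≈ : ∀ t → NonZero t → R (ℤ.- (+ t)) a a≢0 ≈ - res 1 moduli (suc t)
    -- The exponent -(t+1) - 1 computes to `-[1+ suc (t ℕ.+ 0) ]`, hence the stray 0. The pole order
    -- is `suc n`, so the residue is the coefficient of index `n`.
    R≈ (suc t) _ = -‿cong (trans
      (quotient≋ (z⁻¹ ^ˢ suc (suc (t ℕ.+ 0))) _ _ denominator-shift n)
      (reflexive (≡.cong (λ t → (z⁻¹ ^ˢ suc (suc t) *ˢ regularPart 1 moduli) n) (ℕₚ.+-identityʳ t))))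

  module _ {m} (a : Vector ℕ (suc m)) (a≢0 : ∀ k → NonZero (a k)) (coprime : PairwiseCoprime a)
           (roots : ∀ j → NontrivialRootsOfUnity (a j)) (t : ℕ) (t≢0 : NonZero t) where
    open ≈-Reasoning setoid

    σs : Vector Carrier (suc m)
    σs j = σ (a j) {{a≢0 j}} (roots j) (ℤ.- (+ t)) (omit a j) (omit-coprime a coprime j)

    term≈σ : ∀ j → (- 1#) ^ suc m * σs j ≈ term 1 (moduli a a≢0 roots) j (suc t)
    -- `omit a j` has length `m ℕ.+ 1`, which is the exponent of the sign in `rootSum≈σ`.
    term≈σ j = trans (*-congʳ (^-congʳ (- 1#) (ℕₚ.+-comm 1 m)))
      (rootSum≈σ (a j) (a≢0 j) (roots j) t t≢0 (omit a j) (omit-coprime a coprime j)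
        (weight (b j) 1 (removeAt b j)) inverse)
      where
      b = moduli a a≢0 roots

      h : Fin (a j ℕ.∸ 1) → ℤ → Carrier
      h i c = 1# - ω (b j) i ^ᶻ c ⟨ root#0 {{a≢0 j}} (root (b j) i) ⟩

      inverse : ∀ i → product (h i ∘ omit a j) * weight (b j) 1 (removeAt b j) i ≈ 1#
      inverse i = begin
        product (h i ∘ omit a j) * (κ₁ * 1# * p)
          ≈⟨ *-congʳ (product-++ (h i) (+_ ∘ removeAt a j) (λ _ → 1ℤ)) ⟩
        product (h i ∘ +_ ∘ removeAt a j) * (h i 1ℤ * 1#) * (κ₁ * 1# * p)
          ≈⟨ solve 4 (λ x y k p → x :* (y :* con 1) :* (k :* con 1 :* p) := x :* p :* (y :* k)) refl (product (h i ∘ +_ ∘ removeAt a j)) (h i 1ℤ) κ₁ p ⟩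
        product (h i ∘ +_ ∘ removeAt a j) * p * (h i 1ℤ * κ₁)
          ≈⟨ *-cong
               (product-inverse λ k → κ-inverse (b j) i (removeAt a j k) (root^#1 (root (b j) i) (coprime (punchInᵢ≢i j k))))
               (κ-inverse (b j) i 1 (root^#1 (root (b j) i) (ℕC.1-coprimeTo (a j)))) ⟩
        1# * 1#
          ≈⟨ *-identityˡ 1# ⟩
        1# ∎
        where
        κ₁ = κ (b j) i 1
        p  = product (κ (b j) i ∘ removeAt a j)

    fourier≈σ : (- 1#) ^ suc m * sum σs ≈ fourier 1 (moduli a a≢0 roots) (suc t)
    fourier≈σ = trans (*-distribˡ-sum ((- 1#) ^ suc m) σs) (sum-cong term≈σ)

    count≈ : count 1 (moduli a a≢0 roots) (suc t) ≈ R (ℤ.- (+ t)) a a≢0 + (- 1#) ^ suc m * sum σs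
    count≈ = trans (residueSum≈0 1 (moduli a a≢0 roots) (suc t) (vanishes (suc m) 1 (moduli a a≢0 roots) coprime _ t))
      (sym (+-cong (R≈ a a≢0 roots t t≢0) fourier≈σ))

-- Cardinalities of setoids

hasCardinality : (S : Setoid c ℓ) (let module S = Setoid S) → ∀ {n} (f : Fin n → S.Carrier) →
                 (∀ {i j} → f i S.≈ f j → i ≡ j) → (∀ x → ∃[ i ] f i S.≈ x) → HasCardinality S n
hasCardinality S f injective surjective = record
  { to        = f
  ; cong      = λ { ≡.refl → Setoid.refl S }
  ; bijective = injective , λ x → proj₁ (surjective x) , λ { ≡.refl → proj₂ (surjective x) }
  }

cardinality-image : (S : Setoid c₁ ℓ₁) (T : Setoid c₂ ℓ₂) (let module S = Setoid S; module T = Setoid T) →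
  ∀ {n} (f : S.Carrier → T.Carrier) → (∀ {x y} → x S.≈ y → f x T.≈ f y) → (∀ {x y} → f x T.≈ f y → x S.≈ y) →
  (∀ y → ∃[ x ] f x T.≈ y) → HasCardinality S n → HasCardinality T n
cardinality-image S T f f-cong f-injective f-surjective #S = hasCardinality T (f ∘ to) (injective ∘ f-injective) λ y →
  let x , fx≈y = f-surjective y ; i , eq = strictlySurjective x in i , Setoid.trans T (f-cong eq) fx≈y
  where open Bijection #S

cardinality-⊎ : (S : Setoid c₁ ℓ₁) (T : Setoid c₂ ℓ₂) (U : Setoid c₃ ℓ₃)
  (let module S = Setoid S; module T = Setoid T; module U = Setoid U) → ∀ {m n}
  (f : S.Carrier → U.Carrier) → (∀ {x y} → x S.≈ y → f x U.≈ f y) → (∀ {x y} → f x U.≈ f y → x S.≈ y) →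
  (g : T.Carrier → U.Carrier) → (∀ {x y} → x T.≈ y → g x U.≈ g y) → (∀ {x y} → g x U.≈ g y → x T.≈ y) →
  (∀ x y → ¬ f x U.≈ g y) → (∀ z → (∃[ x ] f x U.≈ z) ⊎ (∃[ y ] g y U.≈ z)) →
  HasCardinality S m → HasCardinality T n → HasCardinality U (m ℕ.+ n)
cardinality-⊎ S T U {m} {n} f f-cong f-inj g g-cong g-inj disjoint cover #S #T =
  hasCardinality U (h ∘ splitAt m) (λ {i} {j} eq → ≡.trans (≡.sym (join-splitAt m n i))
    (≡.trans (≡.cong (join m n) (h-inj (splitAt m i) (splitAt m j) eq)) (join-splitAt m n j)))
    λ z → let s , eq = h-surj z in join m n s , U.trans (U.reflexive (≡.cong h (splitAt-join m n s))) eq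
  where
  module U = Setoid U
  module #S = Bijection #S
  module #T = Bijection #T

  h : Fin m ⊎ Fin n → U.Carrier
  h = [ f ∘ #S.to , g ∘ #T.to ]′

  h-inj : ∀ s s′ → h s U.≈ h s′ → s ≡ s′
  h-inj (inj₁ i) (inj₁ j) eq = ≡.cong inj₁ (#S.injective (f-inj eq))
  h-inj (inj₁ i) (inj₂ j) eq = ⊥-elim (disjoint _ _ eq)
  h-inj (inj₂ i) (inj₁ j) eq = ⊥-elim (disjoint _ _ (U.sym eq))
  h-inj (inj₂ i) (inj₂ j) eq = ≡.cong inj₂ (#T.injective (g-inj eq))

  h-surj : ∀ z → ∃[ s ] h s U.≈ z
  h-surj z with cover z
  ... | inj₁ (x , eq) = inj₁ (proj₁ (#S.strictlySurjective x)) , U.trans (f-cong (proj₂ (#S.strictlySurjective x))) eq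
  ... | inj₂ (y , eq) = inj₂ (proj₁ (#T.strictlySurjective y)) , U.trans (g-cong (proj₂ (#T.strictlySurjective y))) eq

-- Natural solutions of a₁x₁ + ⋯ + aₙxₙ ≤ t

dot : ∀ {n} → Vector ℕ n → Vector ℕ n → ℕ
dot a x = SemiringSum.sum ℕₚ.+-*-semiring λ k → a k ℕ.* x k

solutions : ∀ {n} → Vector ℕ n → ℕ → Setoid _ _
solutions {n} a t = On.setoid {B = ∃[ x ] dot a x ℕ.≤ t} (VectorEquality.≋-setoid (≡.setoid ℕ) n) proj₁

module _ {n} (a : Vector ℕ (suc n)) where
  private
    a₀ = a Fin.zero

  0∷ : ∀ {t} → Setoid.Carrier (solutions (tail a) t) → Setoid.Carrier (solutions a t)
  0∷ {t} (x , ax≤t) = 0 ∷ x , ≡.subst (ℕ._≤ t) (≡.cong (ℕ._+ dot (tail a) x) (≡.sym (ℕₚ.*-zeroʳ a₀))) ax≤t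

  dot-suc : ∀ m x → dot a (suc m ∷ x) ≡ a₀ ℕ.+ dot a (m ∷ x)
  dot-suc m x = ≡.trans (≡.cong (ℕ._+ dot (tail a) x) (ℕₚ.*-suc a₀ m)) (ℕₚ.+-assoc a₀ (a₀ ℕ.* m) _)

  suc∷ : ∀ {t} → Setoid.Carrier (solutions a t) → Setoid.Carrier (solutions a (a₀ ℕ.+ t))
  suc∷ {t} (x , ax≤t) = suc (x Fin.zero) ∷ tail x ,
    ≡.subst (ℕ._≤ a₀ ℕ.+ t) (≡.sym (dot-suc (x Fin.zero) (tail x))) (ℕₚ.+-monoʳ-≤ a₀ ax≤t)

  zeroHead : ∀ {t} (y : Setoid.Carrier (solutions a t)) → proj₁ y Fin.zero ≡ 0 →
             ∃[ x ] Setoid._≈_ (solutions a t) (0∷ x) y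
  zeroHead {t} (y , ay≤t) y₀≡0 = (tail y , ℕₚ.≤-trans (ℕₚ.m≤n+m _ (a₀ ℕ.* y Fin.zero)) ay≤t) ,
    λ { Fin.zero → ≡.sym y₀≡0 ; (Fin.suc k) → ≡.refl }

  sucHead : ∀ {t m} (y : Setoid.Carrier (solutions a t)) → proj₁ y Fin.zero ≡ suc m →
            a₀ ℕ.+ dot a (m ∷ tail (proj₁ y)) ℕ.≤ t
  sucHead {t} {m} (y , ay≤t) y₀≡1+m = ≡.subst (ℕ._≤ t)
    (≡.trans (≡.cong (λ y₀ → a₀ ℕ.* y₀ ℕ.+ dot (tail a) (tail y)) y₀≡1+m) (dot-suc m (tail y))) ay≤t

  solutions-< : ∀ {t L} → t ℕ.< a₀ → HasCardinality (solutions (tail a) t) L → HasCardinality (solutions a t) L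
  solutions-< {t} t<a₀ = cardinality-image (solutions (tail a) t) (solutions a t) 0∷
    (λ x≈y → λ { Fin.zero → ≡.refl ; (Fin.suc k) → x≈y k }) (λ eq → eq ∘ Fin.suc)
    -- A functional vector cannot be matched on, so its head is passed along with an equation.
    λ y → zeroHead y (y₀≡0 y (proj₁ y Fin.zero) ≡.refl)
    where
    y₀≡0 : ∀ y y₀ → proj₁ y Fin.zero ≡ y₀ → proj₁ y Fin.zero ≡ 0
    y₀≡0 y zero    eq = eq
    y₀≡0 y (suc m) eq = ⊥-elim (ℕₚ.<-irrefl ≡.refl (ℕₚ.<-≤-trans t<a₀ (ℕₚ.≤-trans (ℕₚ.m≤m+n a₀ _) (sucHead {t} y eq))))

  -- Either the first coordinate is 0, or lowering it by 1 lowers the bound by `a₀`. This is the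
  -- recurrence of `countSeries-+`.
  solutions-+ : ∀ {t L M} → HasCardinality (solutions (tail a) (a₀ ℕ.+ t)) L → HasCardinality (solutions a t) M →
                HasCardinality (solutions a (a₀ ℕ.+ t)) (L ℕ.+ M)
  solutions-+ {t} = cardinality-⊎ (solutions (tail a) (a₀ ℕ.+ t)) (solutions a t) (solutions a (a₀ ℕ.+ t))
    0∷ (λ x≈y → λ { Fin.zero → ≡.refl ; (Fin.suc k) → x≈y k }) (λ eq → eq ∘ Fin.suc)
    suc∷ (λ x≈y → λ { Fin.zero → ≡.cong suc (x≈y Fin.zero) ; (Fin.suc k) → x≈y (Fin.suc k) })
    (λ eq → λ { Fin.zero → ℕₚ.suc-injective (eq Fin.zero) ; (Fin.suc k) → eq (Fin.suc k) })
    (λ x y eq → ℕₚ.0≢1+n (eq Fin.zero))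
    λ y → cover y (proj₁ y Fin.zero) ≡.refl
    where
    cover : ∀ y y₀ → proj₁ y Fin.zero ≡ y₀ →
            (∃[ x ] Setoid._≈_ (solutions a (a₀ ℕ.+ t)) (0∷ x) y) ⊎ (∃[ x ] Setoid._≈_ (solutions a (a₀ ℕ.+ t)) (suc∷ x) y)
    cover y zero    eq = inj₁ (zeroHead {a₀ ℕ.+ t} y eq)
    cover y (suc m) eq = inj₂ ((m ∷ tail (proj₁ y) , ℕₚ.+-cancelˡ-≤ a₀ _ _ (sucHead {a₀ ℕ.+ t} y eq)) ,
      λ { Fin.zero → ≡.sym eq ; (Fin.suc k) → ≡.refl })

-- The generating function of the numbers of solutions

module Counting (K : HeytingField c ℓ₁ ℓ₂) (char0 : CharacteristicZero K) where
  open HeytingFieldArithmetic K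
  open RootSums K char0 using (module Modulus; Modulus)
  open ExpansionAt1 K
  open SeriesSemiring K
  open GeneratingFunctions K char0
  open Modulus
  open SemiringMult semiring using (×-homo-1; ×-homo-+)

  module _ {n} (b : Vector Modulus (suc n)) where
    private
      b₀ = modulus (b Fin.zero)

      step : countSeries 1 b ≋ 1ˢ *ˢ countSeries 1 (tail b) +ˢ w ^ˢ b₀ *ˢ countSeries 1 b
      step = SemiringIdentities.product-step seriesSemiring (λ k → J (modulus (b k)) (nonZero (b k))) Fin.zero {1ˢ} {w ^ˢ b₀}
        (J-step b₀ (nonZero (b Fin.zero))) (J 1 _ ^ˢ 1)

    countSeries-< : ∀ {t} → t ℕ.< b₀ → countSeries 1 b t ≈ countSeries 1 (tail b) t
    countSeries-< {t} t<b₀ = trans (step t) (trans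
      (+-cong (*ˢ-identityˡ (countSeries 1 (tail b)) t) (w^*-< b₀ (countSeries 1 b) t<b₀)) (+-identityʳ _))

    countSeries-+ : ∀ t → countSeries 1 b (b₀ ℕ.+ t) ≈ countSeries 1 (tail b) (b₀ ℕ.+ t) + countSeries 1 b t
    countSeries-+ t = trans (step (b₀ ℕ.+ t))
      (+-cong (*ˢ-identityˡ (countSeries 1 (tail b)) (b₀ ℕ.+ t)) (w^*-+ b₀ (countSeries 1 b) t))

  -- The factor 1 / (1 - w) accounts for the slack in the inequality: without variables there is one
  -- solution for every `t`, and all its coefficients are 1. Each further variable is treated by
  -- strong recursion on `t` in steps of `b₀`.
  solutions-cardinality : ∀ {n} (b : Vector Modulus n) t →
    ∃[ L ] HasCardinality (solutions (modulus ∘ b) t) L × L · 1# ≈ countSeries 1 b t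
  solutions-cardinality {zero} b t = 1 ,
    hasCardinality (solutions (modulus ∘ b) t) (λ _ → (λ ()) , z≤n) (λ { {Fin.zero} {Fin.zero} _ → ≡.refl ; {Fin.suc ()} ; {j = Fin.suc ()} }) (λ _ → Fin.zero , λ ()) ,
    trans (×-homo-1 1#) (sym (countSeries-[] b t))
  solutions-cardinality {suc n} b = <-rec _ λ t rec → go t rec (t ℕₚ.<? b₀)
    where
    b₀ = modulus (b Fin.zero)

    P : ℕ → Set _
    P t = ∃[ L ] HasCardinality (solutions (modulus ∘ b) t) L × L · 1# ≈ countSeries 1 b t

    ge : ∀ s → P s → P (b₀ ℕ.+ s)
    ge s (M , #M , M≈) =
      let L , #L , L≈ = solutions-cardinality (tail b) (b₀ ℕ.+ s) in
      L ℕ.+ M , solutions-+ (modulus ∘ b) #L #M ,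
      trans (×-homo-+ 1# L M) (trans (+-cong L≈ M≈) (sym (countSeries-+ b s)))

    go : ∀ t → (∀ {s} → s ℕ.< t → P s) → _ → P t
    go t rec (yes t<b₀) =
      let L , #L , L≈ = solutions-cardinality (tail b) t in
      L , solutions-< (modulus ∘ b) t<b₀ #L , trans L≈ (sym (countSeries-< b t<b₀))
    go t rec (no t≮b₀) = ≡.subst P (ℕₚ.m+[n∸m]≡n b₀≤t)
      (ge (t ℕ.∸ b₀) (rec (ℕₚ.∸-monoʳ-< (ℕ.>-nonZero⁻¹ b₀ {{nonZero (b Fin.zero)}}) b₀≤t)))
      where b₀≤t = ℕₚ.≮⇒≥ t≮b₀

module Solutions {c ℓ₁ ℓ₂} (K : HeytingField c ℓ₁ ℓ₂) (char0 : CharacteristicZero K) where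
  open HeytingFieldArithmetic K
  open RootsOfUnity K using (NontrivialRootsOfUnity)
  open FourierDedekind K char0 using (σ)
  open Residue K char0 using (R)
  open GeneratingFunctions K char0 using (w*-suc; countSeries)
  open Comparison K char0 using (moduli; count≈)
  open Counting K char0 using (solutions-cardinality)

  -- For an arbitrary conclusion C, so that theorem1 is an instance without any
  -- conversion: comparing types that unfold over ℂ is intractable.
  cardinality-formula : ∀ {p} (C : ∀ {n} → Vector ℕ n → ℕ → ℕ → Set p) →
    (∀ {n} (a : Vector ℕ n) t → NonZero t → ∀ {L} → HasCardinality (solutions a t) L → C a t L) →
    ∀ m (a : Vector ℕ (suc m)) (a≢0 : ∀ k → NonZero (a k)) (coprime : PairwiseCoprime a)
    (roots : ∀ j → NontrivialRootsOfUnity (a j)) (t : ℕ) → NonZero t →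
    ∃[ L ] C a t L × L · 1# ≈ R (ℤ.- (+ t)) a a≢0 +
      (- 1#) ^ suc m * sum (λ j → σ (a j) {{a≢0 j}} (roots j) (ℤ.- (+ t)) (omit a j) (omit-coprime a coprime j))
  cardinality-formula C solutions⇒C m a a≢0 coprime roots t t≢0 =
    let b = moduli a a≢0 roots
        L , #L , L≈ = solutions-cardinality b t
    in L , solutions⇒C a t t≢0 #L , trans L≈ (trans (sym (w*-suc (countSeries 1 b) t)) (count≈ a a≢0 coprime roots t t≢0))

-- Lattice points of the dilated polytope

module LatticePoints {c ℓ₁ ℓ₂} (ℝ : RealNumbers c ℓ₁ ℓ₂) where
  open RealNumbers ℝ
  open OrderLemmas ℝ
  open Polytope ℝ
  open SemiringMult semiring using (×-congʳ; ×-homo-+; ×-assocˡ; ×-assoc-*; ×-comm-*)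
  open SemiringSum semiring using (*-distribˡ-sum)
  open ≈-Reasoning setoid

  *-monoʳ-< : ∀ {x y z} → 0# < x → y < z → x * y < x * z
  *-monoʳ-< {x} {y} {z} 0<x y<z = <-respˡ-≈ (+-identityʳ _) (<-respʳ-≈ (begin
    x * y + x * (- y + z)    ≈⟨ distribˡ x y (- y + z) ⟨
    x * (y + (- y + z))      ≈⟨ *-congˡ (trans (sym (+-assoc _ _ _)) (trans (+-congʳ (-‿inverseʳ y)) (+-identityˡ z))) ⟩
    x * z                    ∎)
    (+-monoʳ-< (x * y) (*-positive 0<x (<-respˡ-≈ (-‿inverseˡ y) (+-monoʳ-< (- y) y<z)))))

  -- Cancelling in the apartness relation leaves `y` and `z` apart, hence comparable, and the wrong
  -- order contradicts monotonicity.
  *-cancelˡ-< : ∀ {x y z} → 0# < x → x * y < x * z → y < z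
  *-cancelˡ-< 0<x xy<xz with #⇒<⊎> (*-strongˡ (<⇒# xy<xz))
  ... | inj₁ y<z = y<z
  ... | inj₂ z<y = ⊥-elim (<-irrefl refl (<-trans xy<xz (*-monoʳ-< 0<x z<y)))

  0<suc·1 : ∀ n → 0# < suc n · 1#
  0<suc·1 n = +-positive 0<1 (0≤n·1 n)

  ·1-mono-< : ∀ {m n} → m ℕ.< n → m · 1# < n · 1#
  ·1-mono-< {zero}  {suc n} _         = 0<suc·1 n
  ·1-mono-< {suc m} {suc n} (s≤s m<n) = +-monoʳ-< 1# (·1-mono-< m<n)

  ·1-cancel-≤ : ∀ {m n} → m · 1# ≤ n · 1# → m ℕ.≤ n
  ·1-cancel-≤ m≤n = ℕₚ.≮⇒≥ (m≤n ∘ ·1-mono-<)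

  ·1-mono-≤ : ∀ {m n} → m ℕ.≤ n → m · 1# ≤ n · 1#
  ·1-mono-≤ {m} {n} m≤n n<m with ℕₚ.m≤n⇒m<n∨m≡n m≤n
  ... | inj₁ m<n    = <-irrefl refl (<-trans n<m (·1-mono-< m<n))
  ... | inj₂ ≡.refl = <-irrefl refl n<m

  n·x≈n·1*x : ∀ n x → n · x ≈ n · 1# * x
  n·x≈n·1*x n x = sym (trans (×-assoc-* n 1# x) (×-congʳ n (*-identityˡ x)))

  module _ {n} (a : Vector ℕ n) (t : ℕ) where
    private
      T = suc t · 1#

    dot-scale : ∀ (m : Vector ℕ n) (x : Vector Carrier n) → (∀ k → m k · 1# ≈ suc t · x k) → T * sum (λ k → a k · x k) ≈ dot a m · 1#
    dot-scale m x m≈tx = begin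
      T * sum (λ k → a k · x k)      ≈⟨ *-distribˡ-sum T (λ k → a k · x k) ⟩
      sum (λ k → T * (a k · x k))    ≈⟨ sum-cong (λ k → begin
        T * (a k · x k)              ≈⟨ ×-comm-* (a k) T (x k) ⟩
        a k · (T * x k)              ≈⟨ ×-congʳ (a k) (trans (m≈tx k) (n·x≈n·1*x (suc t) (x k))) ⟨
        a k · (m k · 1#)             ≈⟨ ×-assocˡ 1# (a k) (m k) ⟩
        (a k ℕ.* m k) · 1#           ∎) ⟩
      sum (λ k → (a k ℕ.* m k) · 1#) ≈⟨ homo (λ k → a k ℕ.* m k) ⟨
      dot a m · 1#                   ∎
      where
      homo : ∀ {n} (v : Vector ℕ n) → SemiringSum.sum ℕₚ.+-*-semiring v · 1# ≈ sum (λ k → v k · 1#)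
      homo {zero}  v = refl
      homo {suc n} v = trans (×-homo-+ 1# (v Fin.zero) _) (+-congˡ (homo (tail v)))

    -- `≤` is the negation of the reversed `<`, so each direction carries a strict inequality
    -- backwards through multiplication by `suc t`.
    dot≤⇔ : ∀ (m : Vector ℕ n) (x : Vector Carrier n) → (∀ k → m k · 1# ≈ suc t · x k) →
            (dot a m ℕ.≤ suc t → sum (λ k → a k · x k) ≤ 1#) × (sum (λ k → a k · x k) ≤ 1# → dot a m ℕ.≤ suc t)
    dot≤⇔ m x m≈tx =
      (λ am≤t 1<ax → ·1-mono-≤ am≤t (<-respˡ-≈ (*-identityʳ T) (<-respʳ-≈ (dot-scale m x m≈tx) (*-monoʳ-< (0<suc·1 t) 1<ax)))) ,
      (λ ax≤1 → ·1-cancel-≤ λ t<am → ax≤1 (*-cancelˡ-< (0<suc·1 t)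
        (<-respˡ-≈ (sym (*-identityʳ T)) (<-respʳ-≈ (sym (dot-scale m x m≈tx)) t<am))))

    tP : Setoid _ _
    tP = latticePoints (dilate (suc t) (𝒫 a))

    -- Lattice points are compared by their integer coordinates alone, so the choice of the real
    -- witness m / t does not affect injectivity.
    toLattice : Setoid.Carrier (solutions a (suc t)) → Setoid.Carrier tP
    toLattice (m , am≤t) = +_ ∘ m , x , ((λ k → 0≤x k) , proj₁ (dot≤⇔ m x m≈tx) am≤t) , m≈tx
      where
      T#0 = #-sym (<⇒# (0<suc·1 t))

      x : Vector Carrier n
      x k = m k · 1# / T ⟨ T#0 ⟩

      Tx≈m : ∀ k → T * x k ≈ m k · 1#
      Tx≈m k = begin
        T * (m k · 1# * inv T T#0)   ≈⟨ *-congˡ (*-comm _ _) ⟩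
        T * (inv T T#0 * m k · 1#)   ≈⟨ *-assoc _ _ _ ⟨
        T * inv T T#0 * m k · 1#     ≈⟨ *-congʳ (inverseʳ T#0) ⟩
        1# * m k · 1#                ≈⟨ *-identityˡ _ ⟩
        m k · 1#                     ∎

      m≈tx : ∀ k → m k · 1# ≈ suc t · x k
      m≈tx k = trans (sym (Tx≈m k)) (sym (n·x≈n·1*x (suc t) (x k)))

      0≤x : ∀ k → 0# ≤ x k
      0≤x k x<0 = 0≤n·1 (m k) (<-respˡ-≈ (Tx≈m k) (<-respʳ-≈ (zeroʳ T) (*-monoʳ-< (0<suc·1 t) x<0)))

    nonNegative : ∀ i {x} → 0# ≤ x → fromℤ i ≈ suc t · x → ∃[ m ] + m ≡ i
    nonNegative (+ m)    _   _       = m , ≡.refl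
    nonNegative -[1+ m ] {x} 0≤x i≈tx = ⊥-elim (0≤x (*-cancelˡ-< (0<suc·1 t)
      (<-respˡ-≈ (trans i≈tx (n·x≈n·1*x (suc t) x)) (<-respʳ-≈ (sym (zeroʳ T))
        (<-respʳ-≈ (-‿inverseˡ _) (<-respˡ-≈ (+-identityʳ _) (+-monoʳ-< _ (0<suc·1 m))))))))

    lattice-surjective : ∀ p → ∃[ s ] Setoid._≈_ tP (toLattice s) p
    lattice-surjective (i , x , (0≤x , ax≤1) , i≈tx) =
      (m , proj₂ (dot≤⇔ m x m≈tx) ax≤1) , m≡i
      where
      m : Vector ℕ n
      m k = proj₁ (nonNegative (i k) (0≤x k) (i≈tx k))

      m≡i : ∀ k → + m k ≡ i k
      m≡i k = proj₂ (nonNegative (i k) (0≤x k) (i≈tx k))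

      m≈tx : ∀ k → m k · 1# ≈ suc t · x k
      m≈tx k = trans (reflexive (≡.cong fromℤ (m≡i k))) (i≈tx k)

  latticePoints-cardinality : ∀ {n} (a : Vector ℕ n) t → NonZero t → ∀ {L} →
    HasCardinality (solutions a t) L → HasCardinality (latticePoints (dilate t (𝒫 a))) L
  latticePoints-cardinality a (suc t) _ = cardinality-image (solutions a (suc t)) (tP a t) (toLattice a t)
    (λ m≈m′ k → ≡.cong +_ (m≈m′ k)) (λ eq k → ℤₚ.+-injective (eq k)) (lattice-surjective a t)

theorem1 : ∀ {c ℓ₁ ℓ₂} (ℝ : RealNumbers c ℓ₁ ℓ₂) → let open LatticePointFormula ℝ in
    ∀ m (a : Vector ℕ (suc m)) (a≢0 : ∀ k → NonZero (a k)) (coprime : PairwiseCoprime a)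
    (roots : ∀ j → NontrivialRootsOfUnity (a j)) (t : ℕ) → NonZero t →
    ∃[ L ] HasCardinality (latticePoints (dilate t (𝒫 a))) L ×
    L · 1# ≈ R (ℤ.- (+ t)) a a≢0 +
    (- 1#) ^ suc m * sum (λ j → σ (a j) {{a≢0 j}} (roots j) (ℤ.- (+ t)) (omit a j) (omit-coprime a coprime j))
theorem1 ℝ = Solutions.cardinality-formula (ComplexNumbers.ℂ ℝ) (ComplexNumbers.ℂ-charZero ℝ)
  (λ a t → HasCardinality (Polytope.latticePoints ℝ (Polytope.dilate ℝ t (Polytope.𝒫 ℝ a))))
  (LatticePoints.latticePoints-cardinality ℝ)
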